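{- Let $q=p$ be a prime and $n/2\le k\le n-1$. Then $C_k(n,q)$ contains no codeword whose weight lies in the open interval $]\theta_k,2q^k[$.
   Context: $\theta_k=(q^{k+1}-1)/(q-1)$. $C_k(n,q)$ is the $p$-ary linear code spanned over $\mathbb{F}_p$ by the rows of the incidence matrix of $k$-dimensional subspaces versus points of $PG(n,q)$; the weight of a codeword is its number of nonzero coordinates. -}

module Defs where

open import Data.Nat using (ℕ; zero; suc; _+_; _*_; _^_; _≡ᵇ_; NonZero)
open import Data.Nat.DivMod using (_mod_)
open import Data.Nat.Primality using (Prime; prime⇒nonZero)
open import Data.Fin using (Fin; toℕ)
open import Data.Vec using (Vec; []; _∷_; replicate; zipWith)
open import Data.List using (List; []; _∷_)
open import Data.Product using (Σ; ∃; _×_; proj₁)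
open import Data.Bool using (Bool; true; false; if_then_else_; T)
open import Relation.Binary.PropositionalEquality using (_≡_)
open import Relation.Nullary using (¬_)

θ : ℕ → ℕ → ℕ
θ q zero    = 1
θ q (suc k) = q ^ suc k + θ q k

module PG (p : ℕ) (pr : Prime p) where

  instance
    p≢0 : NonZero p
    p≢0 = prime⇒nonZero pr

  F : Set
  F = Fin p

  0F 1F : F
  0F = 0 mod p
  1F = 1 mod p

  _+F_ _*F_ : F → F → F
  a +F b = (toℕ a + toℕ b) mod p
  a *F b = (toℕ a * toℕ b) mod p

  V : ℕ → Set
  V m = Vec F m

  zeroV : ∀ {m} → V m
  zeroV = replicate _ 0F

  _+V_ : ∀ {m} → V m → V m → V m
  _+V_ = zipWith _+F_

  _·V_ : ∀ {m} → F → V m → V m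
  a ·V x = Data.Vec.map (a *F_) x

  lincomb : ∀ {m r} → V r → Vec (V m) r → V m
  lincomb []       []       = zeroV
  lincomb (a ∷ as) (b ∷ bs) = (a ·V b) +V lincomb as bs

  normalized : ∀ {m} → V m → Bool
  normalized []       = false
  normalized (a ∷ xs) = if toℕ a ≡ᵇ 0 then normalized xs else (toℕ a ≡ᵇ 1)

  -- points of PG(n,p): nonzero vectors of F_p^{n+1} in normalized form
  -- (one canonical representative per 1-dimensional subspace)
  Point : ℕ → Set
  Point n = Σ (V (suc n)) (λ x → T (normalized x))

  -- a k-dimensional subspace of PG(n,p), given by a basis of the
  -- corresponding (k+1)-dimensional subspace of F_p^{n+1}
  Independent : ∀ {m r} → Vec (V m) r → Set
  Independent B = ∀ a → lincomb a B ≡ zeroV → a ≡ zeroV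

  Subspace : ℕ → ℕ → Set
  Subspace n k = Σ (Vec (V (suc n)) (suc k)) Independent

  _∈S_ : ∀ {n k} → Point n → Subspace n k → Set
  x ∈S S = ∃ λ a → lincomb a (proj₁ S) ≡ proj₁ x

  IsIncidence : ∀ {n k} → Subspace n k → (Point n → F) → Set
  IsIncidence S χ = ∀ x → (x ∈S S → χ x ≡ 1F) × (¬ (x ∈S S) → χ x ≡ 0F)

  Word : ℕ → Set
  Word n = Point n → F

  record Term (n k : ℕ) : Set where
    constructor term
    field
      coeff : F
      subsp : Subspace n k
      chi   : Word n
      isInc : IsIncidence subsp chi

  evalTerms : ∀ {n k} → List (Term n k) → Word n
  evalTerms []       x = 0F
  evalTerms (t ∷ ts) x = (Term.coeff t *F Term.chi t x) +F evalTerms ts x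

  InCode : (n k : ℕ) → Word n → Set
  InCode n k c = ∃ λ (ts : List (Term n k)) → ∀ x → c x ≡ evalTerms ts x

  Support : ∀ {n} → Word n → Set
  Support {n} c = Σ (Point n) (λ x → ¬ (c x ≡ 0F))

  HasWeight : ∀ {n} → Word n → ℕ → Set
  HasWeight c w = Fin w ↔ Support c
    where open import Function.Bundles using (_↔_)

{-# OPTIONS --safe #-}
module Submission where

-- A codeword of C_k extends to a function f on V = F_p^(n+1) which is constant on punctured
-- lines and orthogonal to every product of fewer than (k+1)(p-1) affine forms.  A nonzero
-- function orthogonal to all products of fewer than e(p-1)+j affine forms has at least
-- (j+1)p^e nonzero values: slice by parallel hyperplanes, where u nonzero slices lose only
-- u-1 orders, the indicator of one slice being a polynomial of degree u-1 on the support.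
--
-- If f(0) = 0 and there are fewer than 2p^k support points, averaging gives a hyperplane
-- H with proportionally few points, so f = 0 on H by induction; then f has at least 2p^k
-- points off H.  If f(0) ≠ 0, induction instead makes the support on H a (k-1)-space T,
-- and averaging over a pencil gives a second hyperplane H' where it is a (k-1)-space T'
-- meeting T in codimension one.  The difference between f and f(0) times the indicator of
-- the span of T and T' vanishes on H and H'; unless it is zero, the slice bound applied to
-- the hyperplanes through H ∩ H' forces at least 2p^k support points.

-- One vector dimension is worth p - 1 orders. A polynomial of degree below p - 1 sums to zero over
-- F_p, so extending a function constantly along one more direction gains p - 1 orders, while
-- passing to one of p parallel slices loses at most as many. The factor 2 in the bound is one saved
-- order: a function vanishing on a hyperplane has at most p - 1 nonempty slices, so each of them
-- loses only p - 2 orders. Working with vectors lets the origin in. Its value f(0), the sum of the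
-- coefficients of the chosen terms, decides between the two cases, and the number of support
-- vectors is p - 1 times the number of points, plus 1 when f(0) is nonzero. When f(0) is nonzero,
-- one hyperplane H does not suffice: on a parallel translate of H the difference from the cone over
-- T has, if nonzero, at least 2p^k values, but the cone may account for p^k of them, which leaves f
-- only p^k where about 2p^k are needed. The second hyperplane H' guarantees one vanishing slice in
-- the pencil; this tips the count, in the tightest cases by a single power of p.

open import Defs
open import Algebra.Bundles using (CommutativeMonoid; CommutativeRing)
open import Algebra.Structures using (IsCommutativeRing)
open import Data.Bool using (Bool; true; false; if_then_else_; T)
open import Data.Bool.Properties using (T-irrelevant)
open import Data.Empty using (⊥; ⊥-elim)
open import Data.Fin using (Fin; zero; suc; toℕ; punchIn; _≟_)
open import Data.Fin.Permutation using (permutation)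
open import Data.Fin.Properties using (toℕ-injective; toℕ-fromℕ<; toℕ<n; punchInᵢ≢i)
open import Data.List using (List; []; _∷_; length; filter; tabulate; allFin)
open import Data.List.Membership.Propositional using (_∈_)
open import Data.List.Membership.Propositional.Properties using (∈-filter⁺; ∈-filter⁻; ∈-allFin; ∈-length)
open import Data.List.Properties using (length-tabulate; length-filter; filter-notAll)
open import Data.List.Relation.Unary.Any as Any using (here; there)
open import Data.Nat as ℕ using (ℕ; zero; suc; z≤n; s≤s; _≤_; _<_; _^_)
open import Data.Nat.Coprimality using (prime⇒coprime; coprime-Bézout)
open import Data.Nat.DivMod using (_%_; _mod_; %-congˡ; n%n≡0; %-distribˡ-+; %-distribˡ-*; m<n⇒m%n≡m; m%n<n; [m+kn]%n≡m%n)
open import Data.Nat.GCD using (module Bézout)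
open import Data.Nat.Primality using (Prime; prime⇒nonTrivial)
import Data.Nat.Properties as ℕₚ
open import Data.Nat.Solver using (module +-*-Solver)
open import Data.Product using (Σ; ∃; _×_; _,_; proj₁; proj₂)
open import Data.Sum using (_⊎_; inj₁; inj₂)
open import Data.Unit using (⊤; tt)
open import Data.Vec as Vec using (Vec; []; _∷_; zipWith; replicate)
open import Data.Vec.Properties using (≡-dec; zipWith-replicate₁; zipWith-comm)
open import Function using (_∘_; Inverse)
open import Level using (0ℓ)
open import Relation.Binary.PropositionalEquality
  using (_≡_; _≢_; refl; sym; trans; cong; cong₂; subst; isEquivalence; module ≡-Reasoning)
open import Relation.Nullary using (¬_; Dec; yes; no; does; contradiction; ¬?)
open import Relation.Unary using (Pred; Decidable)

-- Iterated sums over F_p^m, in a commutative monoid: field values and counts alike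

module VectorSum {c ℓ} (M : CommutativeMonoid c ℓ) (n : ℕ) where
  open CommutativeMonoid M using (Carrier; _≈_; _∙_; ε; setoid; ∙-congˡ; identityʳ)
    renaming (refl to ≈-refl; sym to ≈-sym; trans to ≈-trans)
  open import Algebra.Properties.CommutativeMonoid.Sum M public
  open import Relation.Binary.Reasoning.Setoid setoid

  sum-cong : ∀ {k} {f g : Fin k → Carrier} → (∀ i → f i ≈ g i) → sum f ≈ sum g
  sum-cong = sum-cong-≋

  sum-zero : ∀ {k} {f : Fin k → Carrier} → (∀ i → f i ≈ ε) → sum f ≈ ε
  sum-zero {k} f≈ε = ≈-trans (sum-cong f≈ε) (sum-replicate-zero k)

  sum-single : ∀ {k} (f : Fin k → Carrier) i → (∀ j → j ≢ i → f j ≈ ε) → sum f ≈ f i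
  sum-single {suc k} f i f≈ε = begin
    sum f                          ≈⟨ sum-remove {i = i} f ⟩
    f i ∙ sum (λ j → f (punchIn i j))
      ≈⟨ ∙-congˡ (sum-zero (λ j → f≈ε (punchIn i j) (punchInᵢ≢i i j))) ⟩
    f i ∙ ε                        ≈⟨ identityʳ _ ⟩
    f i                            ∎

  sum-reindex : ∀ {k} (f : Fin k → Carrier) (σ τ : Fin k → Fin k) →
                (∀ i → σ (τ i) ≡ i) → (∀ i → τ (σ i) ≡ i) →
                sum (f ∘ σ) ≈ sum f
  sum-reindex f σ τ στ τσ = ≈-sym (sum-permute f (permutation σ τ στ τσ))

  ΣV : ∀ {m} → (Vec (Fin n) m → Carrier) → Carrier
  ΣV {zero}  g = g []
  ΣV {suc m} g = sum (λ t → ΣV (λ x → g (t ∷ x)))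

  ΣV-cong : ∀ {m} {g h : Vec (Fin n) m → Carrier} → (∀ x → g x ≈ h x) → ΣV g ≈ ΣV h
  ΣV-cong {zero}  g≈h = g≈h []
  ΣV-cong {suc m} g≈h = sum-cong (λ t → ΣV-cong (λ x → g≈h (t ∷ x)))

  ΣV-zero : ∀ {m} {g : Vec (Fin n) m → Carrier} → (∀ x → g x ≈ ε) → ΣV g ≈ ε
  ΣV-zero {zero}  g≈ε = g≈ε []
  ΣV-zero {suc m} g≈ε = sum-zero (λ t → ΣV-zero (λ x → g≈ε (t ∷ x)))

  ΣV-single : ∀ {m} (g : Vec (Fin n) m → Carrier) x → (∀ y → y ≢ x → g y ≈ ε) → ΣV g ≈ g x
  ΣV-single {zero}  g []      g≈ε = ≈-refl
  ΣV-single {suc m} g (t ∷ x) g≈ε = ≈-trans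
    (sum-single _ t (λ s s≢t → ΣV-zero (λ y → g≈ε (s ∷ y) (s≢t ∘ cong Vec.head))))
    (ΣV-single (λ y → g (t ∷ y)) x (λ y y≢x → g≈ε (t ∷ y) (y≢x ∘ cong Vec.tail)))

  ΣV-∙ : ∀ {m} (g h : Vec (Fin n) m → Carrier) → ΣV (λ x → g x ∙ h x) ≈ ΣV g ∙ ΣV h
  ΣV-∙ {zero}  g h = ≈-refl
  ΣV-∙ {suc m} g h = ≈-trans (sum-cong (λ t → ΣV-∙ (λ x → g (t ∷ x)) (λ x → h (t ∷ x))))
                           (∑-distrib-+ (λ t → ΣV (λ x → g (t ∷ x))) (λ t → ΣV (λ x → h (t ∷ x))))

  sum-ΣV-comm : ∀ {k m} (g : Fin k → Vec (Fin n) m → Carrier) →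
                sum (λ t → ΣV (g t)) ≈ ΣV (λ x → sum (λ t → g t x))
  sum-ΣV-comm {m = zero}  g = ≈-refl
  sum-ΣV-comm {m = suc m} g = ≈-trans
    (∑-comm (λ t s → ΣV (λ x → g t (s ∷ x))))
    (sum-cong (λ s → sum-ΣV-comm (λ t x → g t (s ∷ x))))

  ΣV-comm : ∀ {l m} (g : Vec (Fin n) l → Vec (Fin n) m → Carrier) →
            ΣV (λ x → ΣV (g x)) ≈ ΣV (λ y → ΣV (λ x → g x y))
  ΣV-comm {zero}  g = ≈-refl
  ΣV-comm {suc l} g = ≈-trans (sum-cong (λ t → ΣV-comm (λ x → g (t ∷ x))))
                            (sum-ΣV-comm (λ t y → ΣV (λ x → g (t ∷ x) y)))

  -- The coordinate bijections carry a parameter per coordinate, so that translation (parameters: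
  -- the shift) and scaling (no information, a vector of `tt`) are both instances.
  ΣV-reindex : ∀ {m} {A : Set} (g : Vec (Fin n) m → Carrier) (σ τ : A → Fin n → Fin n) →
               (∀ a i → σ a (τ a i) ≡ i) → (∀ a i → τ a (σ a i) ≡ i) →
               (as : Vec A m) → ΣV (λ x → g (zipWith σ as x)) ≈ ΣV g
  ΣV-reindex {zero}  g σ τ στ τσ []       = ≈-refl
  ΣV-reindex {suc m} g σ τ στ τσ (a ∷ as) = ≈-trans
    (sum-cong (λ t → ΣV-reindex (λ x → g (σ a t ∷ x)) σ τ στ τσ as))
    (sum-reindex (λ t → ΣV (λ x → g (t ∷ x))) (σ a) (τ a) (στ a) (τσ a))

  ΣV-fibres : ∀ {m k} (g : Vec (Fin n) m → Carrier) (h : Fin k → Vec (Fin n) m → Carrier)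
              (φ : Vec (Fin n) m → Fin k) →
              (∀ x → h (φ x) x ≈ g x) → (∀ t x → t ≢ φ x → h t x ≈ ε) →
              sum (λ t → ΣV (h t)) ≈ ΣV g
  ΣV-fibres g h φ on off = ≈-trans (sum-ΣV-comm h)
    (ΣV-cong (λ x → ≈-trans (sum-single (λ t → h t x) (φ x) (λ t → off t x)) (on x)))

-- In the instance below node i = i and newton i t = t (t - 1) ⋯ (t - i + 1).
record PrimeField (p q : ℕ) : Set where
  infixl 6 _+_
  infixl 7 _*_
  infix  8 -_
  field
    p≡1+q             : p ≡ suc q
    1≤q               : 1 ℕ.≤ q
    _+_ _*_           : Fin p → Fin p → Fin p
    -_                : Fin p → Fin p
    0# 1#             : Fin p
    isCommutativeRing : IsCommutativeRing _≡_ _+_ _*_ -_ 0# 1#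
    1≢0               : 1# ≢ 0#
    inverse           : ∀ a → a ≢ 0# → ∃ λ b → b * a ≡ 1#
    node              : ℕ → Fin p
    newton            : ℕ → Fin p → Fin p
    newton-zero       : ∀ t → newton 0 t ≡ 1#
    newton-suc        : ∀ i t → t * newton i t ≡ newton (suc i) t + node i * newton i t
    newton-sum        : ∀ i → i ℕ.< q →
      VectorSum.sum (CommutativeRing.+-commutativeMonoid
        (record { isCommutativeRing = isCommutativeRing })) p (newton i) ≡ 0#

-- Vectors and linear forms over F_p

module LinearAlgebra {p q : ℕ} (K : PrimeField p q) where
  open PrimeField K

  F : Set
  F = Fin p

  V : ℕ → Set
  V = Vec F

  commutativeRing : CommutativeRing 0ℓ 0ℓ
  commutativeRing = record { isCommutativeRing = isCommutativeRing }

  open CommutativeRing commutativeRing public using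
    ( +-assoc; +-comm; +-identityˡ; +-identityʳ; -‿inverseˡ; -‿inverseʳ
    ; *-assoc; *-comm; *-identityˡ; *-identityʳ; distribˡ; distribʳ; zeroˡ; zeroʳ
    ; +-commutativeMonoid; commutativeSemiring; semiring; ring )
  open import Algebra.Properties.Ring ring public
    using (-‿distribˡ-*; -‿distribʳ-*; -0#≈0#; -‿+-comm)
  open import Algebra.Solver.Ring.NaturalCoefficients.Default commutativeSemiring
    using (solve; _:+_; _:*_; _:=_)

  module S = VectorSum +-commutativeMonoid p
  module C = VectorSum ℕₚ.+-0-commutativeMonoid p
  open import Algebra.Properties.Semiring.Sum semiring using (*-distribˡ-sum)

  infixl 6 _⊕_
  infixr 7 _⊙_

  _⊕_ : ∀ {m} → V m → V m → V m
  _⊕_ = zipWith _+_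

  _⊙_ : ∀ {m} → F → V m → V m
  s ⊙ x = Vec.map (s *_) x

  𝟎 : ∀ {m} → V m
  𝟎 = replicate _ 0#

  dot : ∀ {m} → V m → V m → F
  dot []      []      = 0#
  dot (a ∷ l) (t ∷ x) = a * t + dot l x

  +-inverse-cancel : ∀ a b → a + b + - b ≡ a
  +-inverse-cancel a b = trans (+-assoc a b (- b))
    (trans (cong (a +_) (-‿inverseʳ b)) (+-identityʳ a))

  inverse-+-cancel : ∀ a b → a + - b + b ≡ a
  inverse-+-cancel a b = trans (+-assoc a (- b) b)
    (trans (cong (a +_) (-‿inverseˡ b)) (+-identityʳ a))

  *-nonzero : ∀ {a b} → a ≢ 0# → b ≢ 0# → a * b ≢ 0#
  *-nonzero {a} {b} a≢0 b≢0 ab≡0 with inverse a a≢0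
  ... | c , ca≡1 = b≢0 (begin
    b           ≡⟨ *-identityˡ b ⟨
    1# * b      ≡⟨ cong (_* b) ca≡1 ⟨
    c * a * b   ≡⟨ *-assoc c a b ⟩
    c * (a * b) ≡⟨ cong (c *_) ab≡0 ⟩
    c * 0#      ≡⟨ zeroʳ c ⟩
    0#          ∎)
    where open ≡-Reasoning

  ⊕-comm : ∀ {m} (x y : V m) → x ⊕ y ≡ y ⊕ x
  ⊕-comm = zipWith-comm +-comm

  ⊕-⊙-⊙ : ∀ {m} (x : V m) s t v → x ⊕ s ⊙ v ⊕ t ⊙ v ≡ x ⊕ (s + t) ⊙ v
  ⊕-⊙-⊙ []      s t []      = refl
  ⊕-⊙-⊙ (a ∷ x) s t (b ∷ v) = cong₂ _∷_
    (solve 4 (λ a b s t → a :+ s :* b :+ t :* b := a :+ (s :+ t) :* b) refl a b s t)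
    (⊕-⊙-⊙ x s t v)

  ⊕-0⊙ : ∀ {m} (x v : V m) → x ⊕ 0# ⊙ v ≡ x
  ⊕-0⊙ []      []      = refl
  ⊕-0⊙ (a ∷ x) (b ∷ v) = cong₂ _∷_ (trans (cong (a +_) (zeroˡ b)) (+-identityʳ a)) (⊕-0⊙ x v)

  ⊕-⊙-cancel : ∀ {m} (x : V m) s v → x ⊕ s ⊙ v ⊕ (- s) ⊙ v ≡ x
  ⊕-⊙-cancel x s v = trans (⊕-⊙-⊙ x s (- s) v)
    (trans (cong (λ r → x ⊕ r ⊙ v) (-‿inverseʳ s)) (⊕-0⊙ x v))

  ⊙-⊕-cancel : ∀ {m} (x : V m) s v → x ⊕ (- s) ⊙ v ⊕ s ⊙ v ≡ x
  ⊙-⊕-cancel x s v = trans (⊕-⊙-⊙ x (- s) s v)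
    (trans (cong (λ r → x ⊕ r ⊙ v) (-‿inverseˡ s)) (⊕-0⊙ x v))

  ⊙-⊕ : ∀ {m} s (x y : V m) → s ⊙ (x ⊕ y) ≡ s ⊙ x ⊕ s ⊙ y
  ⊙-⊕ s []      []      = refl
  ⊙-⊕ s (a ∷ x) (b ∷ y) = cong₂ _∷_ (distribˡ s a b) (⊙-⊕ s x y)

  ⊕-interchange : ∀ {m} (w x y z : V m) → (w ⊕ x) ⊕ (y ⊕ z) ≡ (w ⊕ y) ⊕ (x ⊕ z)
  ⊕-interchange []      []      []      []      = refl
  ⊕-interchange (a ∷ w) (b ∷ x) (c ∷ y) (d ∷ z) = cong₂ _∷_
    (solve 4 (λ a b c d → a :+ b :+ (c :+ d) := a :+ c :+ (b :+ d)) refl a b c d)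
    (⊕-interchange w x y z)

  ⊙-+ : ∀ {m} s t (x : V m) → (s + t) ⊙ x ≡ s ⊙ x ⊕ t ⊙ x
  ⊙-+ s t []      = refl
  ⊙-+ s t (a ∷ x) = cong₂ _∷_ (distribʳ a s t) (⊙-+ s t x)

  ⊙-⊙ : ∀ {m} s t (x : V m) → s ⊙ t ⊙ x ≡ (s * t) ⊙ x
  ⊙-⊙ s t []      = refl
  ⊙-⊙ s t (a ∷ x) = cong₂ _∷_ (sym (*-assoc s t a)) (⊙-⊙ s t x)

  1⊙ : ∀ {m} (x : V m) → 1# ⊙ x ≡ x
  1⊙ []      = refl
  1⊙ (a ∷ x) = cong₂ _∷_ (*-identityˡ a) (1⊙ x)

  0⊙ : ∀ {m} (x : V m) → 0# ⊙ x ≡ 𝟎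
  0⊙ []      = refl
  0⊙ (a ∷ x) = cong₂ _∷_ (zeroˡ a) (0⊙ x)

  ⊙𝟎 : ∀ {m} s → s ⊙ 𝟎 {m} ≡ 𝟎
  ⊙𝟎 {zero}  s = refl
  ⊙𝟎 {suc m} s = cong₂ _∷_ (zeroʳ s) (⊙𝟎 s)

  𝟎⊕ : ∀ {m} (x : V m) → 𝟎 ⊕ x ≡ x
  𝟎⊕ []      = refl
  𝟎⊕ (a ∷ x) = cong₂ _∷_ (+-identityˡ a) (𝟎⊕ x)

  ⊙-inverse : ∀ {m} {s r} → r * s ≡ 1# → (x : V m) → r ⊙ s ⊙ x ≡ x
  ⊙-inverse {s = s} {r} rs≡1 x =
    trans (⊙-⊙ r s x) (trans (cong (_⊙ x) rs≡1) (1⊙ x))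

  ⊙-⊖ : ∀ {m} s (x : V m) a v → s ⊙ (x ⊕ (- a) ⊙ v) ≡ s ⊙ x ⊕ (- (s * a)) ⊙ v
  ⊙-⊖ s x a v = trans (⊙-⊕ s x ((- a) ⊙ v)) (cong (s ⊙ x ⊕_)
    (trans (⊙-⊙ s (- a) v) (cong (_⊙ v) (sym (-‿distribʳ-* s a)))))

  dot-⊕ : ∀ {m} (l x y : V m) → dot l (x ⊕ y) ≡ dot l x + dot l y
  dot-⊕ []      []      []      = sym (+-identityˡ 0#)
  dot-⊕ (a ∷ l) (s ∷ x) (t ∷ y) = trans (cong (a * (s + t) +_) (dot-⊕ l x y))
    (solve 5 (λ a s t u v → a :* (s :+ t) :+ (u :+ v) := a :* s :+ u :+ (a :* t :+ v))
      refl a s t (dot l x) (dot l y))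

  dot-comm : ∀ {m} (l x : V m) → dot l x ≡ dot x l
  dot-comm []      []      = refl
  dot-comm (a ∷ l) (t ∷ x) = cong₂ _+_ (*-comm a t) (dot-comm l x)

  dot-⊙ : ∀ {m} (l : V m) s x → dot l (s ⊙ x) ≡ s * dot l x
  dot-⊙ []      s []      = sym (zeroʳ s)
  dot-⊙ (a ∷ l) s (t ∷ x) = trans (cong (a * (s * t) +_) (dot-⊙ l s x))
    (solve 4 (λ a s t u → a :* (s :* t) :+ s :* u := s :* (a :* t :+ u)) refl a s t (dot l x))

  dot-⊕-⊙ : ∀ {m} (l x : V m) s v → dot l (x ⊕ s ⊙ v) ≡ dot l x + s * dot l v
  dot-⊕-⊙ l x s v = trans (dot-⊕ l x (s ⊙ v)) (cong (dot l x +_) (dot-⊙ l s v))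

  dot-𝟎 : ∀ {m} (l : V m) → dot l 𝟎 ≡ 0#
  dot-𝟎 []      = refl
  dot-𝟎 (a ∷ l) = trans (cong₂ _+_ (zeroʳ a) (dot-𝟎 l)) (+-identityˡ 0#)

  dot-𝟎ˡ : ∀ {m} (x : V m) → dot 𝟎 x ≡ 0#
  dot-𝟎ˡ x = trans (dot-comm 𝟎 x) (dot-𝟎 x)

  dot-pencil : ∀ {m} (l k : V m) s x → dot (l ⊕ s ⊙ k) x ≡ dot l x + s * dot k x
  dot-pencil l k s x = trans (dot-comm _ x) (trans (dot-⊕-⊙ x l s k)
    (cong₂ (λ a b → a + s * b) (dot-comm x l) (dot-comm x k)))

  dual-vector : ∀ {m} (x : V m) → x ≢ 𝟎 → ∃ λ e → dot e x ≡ 1#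
  dual-vector []      x≢0 = contradiction refl x≢0
  dual-vector (t ∷ x) x≢0 with t ≟ 0#
  ... | no t≢0 with inverse t t≢0
  ...   | r , rt≡1 = r ∷ 𝟎 , trans (cong₂ _+_ rt≡1 (dot-𝟎ˡ x)) (+-identityʳ 1#)
  dual-vector (t ∷ x) x≢0 | yes refl
    with dual-vector x (λ { refl → x≢0 refl })
  ... | e , ex≡1 = 0# ∷ e , trans (cong₂ _+_ (zeroˡ 0#) ex≡1) (+-identityˡ 1#)

  module Reindex {c ℓ} (M : CommutativeMonoid c ℓ) where
    open CommutativeMonoid M using (Carrier; _≈_; setoid)
    open VectorSum M p using (ΣV; ΣV-cong; ΣV-reindex)
    open import Relation.Binary.Reasoning.Setoid setoid

    ΣV-translate : ∀ {m} (g : V m → Carrier) v → ΣV (λ x → g (x ⊕ v)) ≈ ΣV g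
    ΣV-translate g v = begin
      ΣV (λ x → g (x ⊕ v)) ≈⟨ ΣV-cong (λ x → CommutativeMonoid.reflexive M (cong g (⊕-comm x v))) ⟩
      ΣV (λ x → g (v ⊕ x)) ≈⟨ ΣV-reindex g _+_ (λ a t → - a + t) cancelˡ cancelʳ v ⟩
      ΣV g                 ∎
      where
      cancelˡ : ∀ a t → a + (- a + t) ≡ t
      cancelˡ a t = trans (sym (+-assoc a (- a) t))
        (trans (cong (_+ t) (-‿inverseʳ a)) (+-identityˡ t))
      cancelʳ : ∀ a t → - a + (a + t) ≡ t
      cancelʳ a t = trans (sym (+-assoc (- a) a t))
        (trans (cong (_+ t) (-‿inverseˡ a)) (+-identityˡ t))

    ΣV-scale : ∀ {m} (g : V m → Carrier) s → s ≢ 0# → ΣV (λ x → g (s ⊙ x)) ≈ ΣV g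
    ΣV-scale g s s≢0 with inverse s s≢0
    ... | r , rs≡1 = begin
      ΣV (λ x → g (s ⊙ x))
        ≈⟨ ΣV-cong (λ x → CommutativeMonoid.reflexive M
             (cong g (sym (zipWith-replicate₁ (times s) tt x)))) ⟩
      ΣV (λ x → g (zipWith (times s) (replicate _ tt) x))
        ≈⟨ ΣV-reindex g (times s) (times r) (λ _ → cancel (trans (*-comm s r) rs≡1))
             (λ _ → cancel rs≡1) (replicate _ tt) ⟩
      ΣV g ∎
      where
      times : F → ⊤ → F → F
      times a _ t = a * t
      cancel : ∀ {a b} → a * b ≡ 1# → ∀ t → a * (b * t) ≡ t
      cancel {a} {b} ab≡1 t = trans (sym (*-assoc a b t))
        (trans (cong (_* t) ab≡1) (*-identityˡ t))

  ΣV-*ˡ : ∀ {m} c (f : V m → F) → S.ΣV (λ x → c * f x) ≡ c * S.ΣV f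
  ΣV-*ˡ {zero}  c f = refl
  ΣV-*ˡ {suc m} c f = trans (S.sum-cong (λ t → ΣV-*ˡ c (λ x → f (t ∷ x))))
                            (sym (*-distribˡ-sum c (λ t → S.ΣV (λ x → f (t ∷ x)))))

-- Orthogonality to products of affine forms

module Orthogonality {p q : ℕ} (K : PrimeField p q) where
  open PrimeField K
  open LinearAlgebra K
  open import Algebra.Solver.Ring.NaturalCoefficients.Default commutativeSemiring
    using (solve; _:+_; _:*_; _:=_)

  record Affine {m} (φ : V m → F) : Set where
    constructor affine
    field
      constant : F
      linear   : V m
      formula  : ∀ x → φ x ≡ constant + dot linear x

  -- Membership in the dual of a generalized Reed-Muller code: products of fewer than N affine forms
  -- span the polynomials of degree below N. The recursion peels off one form at a time, which is
  -- how every closure property below is proved.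
  Orth : ∀ {m} → ℕ → (V m → F) → Set
  Orth zero    f = ⊤
  Orth (suc N) f = S.ΣV f ≡ 0# × (∀ φ → Affine φ → Orth N (λ x → φ x * f x))

  dot-affine : ∀ {m} (l : V m) → Affine (dot l)
  dot-affine l = affine 0# l (λ x → sym (+-identityˡ _))

  shift-affine : ∀ {m} {φ : V m → F} c → Affine φ → Affine (λ x → φ x + c)
  shift-affine c (affine d l φ≡) = affine (d + c) l (λ x → trans (cong (_+ c) (φ≡ x))
    (solve 3 (λ a b c → a :+ b :+ c := a :+ c :+ b) refl d (dot l x) c))

  tail-affine : ∀ {m} {φ : V m → F} → Affine φ → Affine (φ ∘ Vec.tail)
  tail-affine (affine d l φ≡) = affine d (0# ∷ l) λ { (t ∷ x) → trans (φ≡ x)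
    (cong (d +_) (sym (trans (cong (_+ dot l x) (zeroˡ t)) (+-identityˡ _)))) }

  orth-cong : ∀ N {m} {f g : V m → F} → (∀ x → f x ≡ g x) → Orth N f → Orth N g
  orth-cong zero    f≡g _          = tt
  orth-cong (suc N) f≡g (Σf≡0 , o) = trans (S.ΣV-cong (λ x → sym (f≡g x))) Σf≡0 ,
    λ φ aff → orth-cong N (λ x → cong (φ x *_) (f≡g x)) (o φ aff)

  orth-+ : ∀ N {m} {f g : V m → F} → Orth N f → Orth N g → Orth N (λ x → f x + g x)
  orth-+ zero    _           _           = tt
  orth-+ (suc N) {f = f} {g} (Σf≡0 , of) (Σg≡0 , og) =
    trans (S.ΣV-∙ f g) (trans (cong₂ _+_ Σf≡0 Σg≡0) (+-identityˡ 0#)) ,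
    λ φ aff → orth-cong N (λ x → sym (distribˡ (φ x) (f x) (g x)))
                (orth-+ N (of φ aff) (og φ aff))

  orth-*ˡ : ∀ N {m} {f : V m → F} c → Orth N f → Orth N (λ x → c * f x)
  orth-*ˡ zero    c _ = tt
  orth-*ˡ (suc N) {f = f} c (Σf≡0 , o) =
    trans (ΣV-*ˡ c f) (trans (cong (c *_) Σf≡0) (zeroʳ c)) ,
    λ φ aff → orth-cong N
      (λ x → solve 3 (λ a b c → a :* (b :* c) := b :* (a :* c)) refl c (φ x) (f x))
      (orth-*ˡ N c (o φ aff))

  orth-mono : ∀ {M N m} {f : V m → F} → N ℕ.≤ M → Orth M f → Orth N f
  orth-mono z≤n       _          = tt
  orth-mono (s≤s N≤M) (Σf≡0 , o) = Σf≡0 , λ φ aff → orth-mono N≤M (o φ aff)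

  orth-zero : ∀ N {m} → Orth {m} N (λ _ → 0#)
  orth-zero zero    = tt
  orth-zero (suc N) {m} = S.ΣV-zero {m} (λ _ → refl) ,
    λ φ aff → orth-cong N (λ x → sym (zeroʳ (φ x))) (orth-zero N)

  restrict : ∀ {m} → (V m → F) → F → (V m → F) → V m → F
  restrict φ t f x = if does (φ x ≟ t) then f x else 0#

  restrict-on : ∀ {m} (φ : V m → F) t f {x} → φ x ≡ t → restrict φ t f x ≡ f x
  restrict-on φ t f {x} φx≡t with φ x ≟ t
  ... | yes _    = refl
  ... | no  φx≢t = contradiction φx≡t φx≢t

  restrict-off : ∀ {m} (φ : V m → F) t f {x} → φ x ≢ t → restrict φ t f x ≡ 0#
  restrict-off φ t f {x} φx≢t with φ x ≟ t
  ... | yes φx≡t = contradiction φx≡t φx≢t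
  ... | no  _    = refl

  restrict-support : ∀ {m} (φ : V m → F) t f {x} → restrict φ t f x ≢ 0# → φ x ≡ t × f x ≢ 0#
  restrict-support φ t f {x} fx≢0 with φ x ≟ t
  ... | yes φx≡t = φx≡t , fx≢0
  ... | no  _    = contradiction refl fx≢0

  vanishing : List F → F → F
  vanishing []       y = 1#
  vanishing (t ∷ ts) y = (y + - t) * vanishing ts y

  vanishing-zero : ∀ {ts t} → t ∈ ts → vanishing ts t ≡ 0#
  vanishing-zero {_ ∷ ts} {t} (here refl) =
    trans (cong (_* vanishing ts t) (-‿inverseʳ t)) (zeroˡ _)
  vanishing-zero {s ∷ ts} {t} (there t∈ts) =
    trans (cong ((t + - s) *_) (vanishing-zero t∈ts)) (zeroʳ _)

  vanishing-nonzero : ∀ ts {t} → ¬ t ∈ ts → vanishing ts t ≢ 0#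
  vanishing-nonzero []       _    = 1≢0
  vanishing-nonzero (s ∷ ts) {t} t∉ = *-nonzero t-s≢0 (vanishing-nonzero ts (t∉ ∘ there))
    where
    t-s≢0 : t + - s ≢ 0#
    t-s≢0 eq = t∉ (here (trans (sym (inverse-+-cancel t s)) (trans (cong (_+ s) eq) (+-identityˡ s))))

  orth-vanishing : ∀ ts {N m} {f φ : V m → F} → Affine φ → Orth (length ts ℕ.+ N) f →
                   Orth N (λ x → vanishing ts (φ x) * f x)
  orth-vanishing []       {N} {f = f} aff o = orth-cong N (λ x → sym (*-identityˡ (f x))) o
  orth-vanishing (t ∷ ts) {N} {f = f} {φ} aff (_ , o) = orth-cong N
    (λ x → solve 3 (λ a b c → a :* (b :* c) := b :* a :* c) refl
      (vanishing ts (φ x)) (φ x + - t) (f x))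
    (orth-vanishing ts aff (o (λ x → φ x + - t) (shift-affine (- t) aff)))

  -- On the support of f, the indicator of φ = t is a polynomial in φ of degree d.
  orth-slice : ∀ {d N m} {f φ : V m → F} (L : List F) {t} → Affine φ →
               (∀ x → f x ≢ 0# → φ x ∈ L) → t ∈ L → length L ℕ.≤ suc d →
               Orth (d ℕ.+ N) f → Orth N (restrict φ t f)
  orth-slice {d} {N} {f = f} {φ} L {t} aff L⊇ t∈L |L|≤1+d o =
    orth-cong N rescaled (orth-*ˡ N c (orth-vanishing ts aff (orth-mono |ts|+N≤d+N o)))
    where
    ≢t? = λ s → ¬? (s ≟ t)
    ts  = filter ≢t? L
    t∉ts : ¬ t ∈ ts
    t∉ts t∈ts = proj₂ (∈-filter⁻ ≢t? {xs = L} t∈ts) refl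
    |ts|+N≤d+N : length ts ℕ.+ N ℕ.≤ d ℕ.+ N
    |ts|+N≤d+N = ℕₚ.+-monoˡ-≤ N (ℕₚ.≤-pred (ℕₚ.≤-trans
      (filter-notAll ≢t? L (Any.map (λ { refl t≢t → t≢t refl }) t∈L)) |L|≤1+d))
    c-inverse = inverse (vanishing ts t) (vanishing-nonzero ts t∉ts)
    c = proj₁ c-inverse
    rescaled : ∀ x → c * (vanishing ts (φ x) * f x) ≡ restrict φ t f x
    rescaled x with φ x ≟ t
    ... | yes φx≡t = trans (sym (*-assoc c _ (f x))) (trans
      (cong (_* f x) (trans (cong (λ s → c * vanishing ts s) φx≡t) (proj₂ c-inverse)))
      (*-identityˡ (f x)))
    -- Off the slice, either f vanishes, or φ x is a value in `L` other than t and hence a root of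
    -- the product.
    ... | no φx≢t with f x ≟ 0#
    ...   | yes fx≡0 = trans (cong (λ a → c * (vanishing ts (φ x) * a)) fx≡0)
                             (trans (cong (c *_) (zeroʳ _)) (zeroʳ c))
    ...   | no fx≢0  = trans (cong (λ a → c * (a * f x))
                               (vanishing-zero (∈-filter⁺ ≢t? (L⊇ x fx≢0) φx≢t)))
                             (trans (cong (c *_) (zeroˡ _)) (zeroʳ c))

  -- A form in the remaining coordinates extends to one that ignores the head, and only the head t
  -- contributes to the sums.
  orth-tail : ∀ N {m} (f : V (suc m) → F) t → (∀ s x → s ≢ t → f (s ∷ x) ≡ 0#) →
              Orth N f → Orth N (λ x → f (t ∷ x))
  orth-tail zero    f t off _          = tt
  orth-tail (suc N) f t off (Σf≡0 , o) =
    trans (sym (S.sum-single _ t (λ s s≢t → S.ΣV-zero (λ x → off s x s≢t)))) Σf≡0 ,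
    λ φ aff → orth-tail N (λ x → φ (Vec.tail x) * f x) t
      (λ s x s≢t → trans (cong (φ x *_) (off s x s≢t)) (zeroʳ (φ x)))
      (o (φ ∘ Vec.tail) (tail-affine aff))

  open Reindex +-commutativeMonoid

  -- Convolution along the direction v with a polynomial weight of degree i. These weighted sums,
  -- and not only the unweighted one, are needed to have a family closed under multiplication by
  -- affine forms.
  smear : ∀ {m} → ℕ → V m → (V m → F) → V m → F
  smear i v g x = S.sum (λ s → newton i s * g (x ⊕ (- s) ⊙ v))

  ΣV-smear : ∀ {m} i v (g : V m → F) → S.ΣV (smear i v g) ≡ S.sum (newton i) * S.ΣV g
  ΣV-smear i v g = begin
    S.ΣV (smear i v g)
      ≡⟨ S.sum-ΣV-comm (λ s x → newton i s * g (x ⊕ (- s) ⊙ v)) ⟨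
    S.sum (λ s → S.ΣV (λ x → newton i s * g (x ⊕ (- s) ⊙ v)))
      ≡⟨ S.sum-cong (λ s → trans (ΣV-*ˡ (newton i s) (λ x → g (x ⊕ (- s) ⊙ v)))
           (cong (newton i s *_) (ΣV-translate g ((- s) ⊙ v)))) ⟩
    S.sum (λ s → newton i s * S.ΣV g)
      ≡⟨ *-distribʳ-sum (S.ΣV g) (newton i) ⟨
    S.sum (newton i) * S.ΣV g ∎
    where open ≡-Reasoning
          open import Algebra.Properties.Semiring.Sum semiring using (*-distribʳ-sum)

  -- The values of φ at x and at the translated point differ by s times δ; the factor s is absorbed
  -- into the weight by `newton-suc`.
  smear-affine : ∀ {m} i v (g φ : V m → F) (aff : Affine φ) x →
    let δ = dot (Affine.linear aff) v in
    φ x * smear i v g x ≡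
      smear i v (λ y → φ y * g y) x + (δ * smear (suc i) v g x + δ * node i * smear i v g x)
  smear-affine i v g φ aff@(affine c l φ≡) x = begin
    φ x * S.sum (λ s → newton i s * g' s)
      ≡⟨ *-distribˡ-sum (φ x) (λ s → newton i s * g' s) ⟩
    S.sum (λ s → φ x * (newton i s * g' s))
      ≡⟨ S.sum-cong termwise ⟩
    S.sum (λ s → newton i s * (φ' s * g' s) +
      (δ * (newton (suc i) s * g' s) + δ * node i * (newton i s * g' s)))
      ≡⟨ S.∑-distrib-+ (λ s → newton i s * (φ' s * g' s)) _ ⟩
    S.sum (λ s → newton i s * (φ' s * g' s)) +
      S.sum (λ s → δ * (newton (suc i) s * g' s) + δ * node i * (newton i s * g' s))
      ≡⟨ cong (S.sum (λ s → newton i s * (φ' s * g' s)) +_) (trans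
           (S.∑-distrib-+ (λ s → δ * (newton (suc i) s * g' s)) _)
           (sym (cong₂ _+_ (*-distribˡ-sum δ (λ s → newton (suc i) s * g' s))
                           (*-distribˡ-sum (δ * node i) (λ s → newton i s * g' s))))) ⟩
    smear i v (λ y → φ y * g y) x + (δ * smear (suc i) v g x + δ * node i * smear i v g x) ∎
    where
    open ≡-Reasoning
    open import Algebra.Properties.Semiring.Sum semiring using (*-distribˡ-sum)
    δ = dot l v
    g' φ' : F → F
    g' s = g (x ⊕ (- s) ⊙ v)
    φ' s = φ (x ⊕ (- s) ⊙ v)
    φx≡ : ∀ s → φ x ≡ φ' s + s * δ
    φx≡ s = begin
      φ x                                            ≡⟨ cong φ (⊙-⊕-cancel x s v) ⟨
      φ (x ⊕ (- s) ⊙ v ⊕ s ⊙ v)                      ≡⟨ φ≡ _ ⟩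
      c + dot l (x ⊕ (- s) ⊙ v ⊕ s ⊙ v)              ≡⟨ cong (c +_) (dot-⊕-⊙ l _ s v) ⟩
      c + (dot l (x ⊕ (- s) ⊙ v) + s * δ)            ≡⟨ +-assoc c _ _ ⟨
      c + dot l (x ⊕ (- s) ⊙ v) + s * δ              ≡⟨ cong (_+ s * δ) (φ≡ _) ⟨
      φ' s + s * δ                                   ∎
    termwise : ∀ s → φ x * (newton i s * g' s) ≡ newton i s * (φ' s * g' s) +
      (δ * (newton (suc i) s * g' s) + δ * node i * (newton i s * g' s))
    termwise s = begin
      φ x * (newton i s * g' s)
        ≡⟨ cong (_* (newton i s * g' s)) (φx≡ s) ⟩
      (φ' s + s * δ) * (newton i s * g' s)
        ≡⟨ solve 5 (λ a s d b g → (a :+ s :* d) :* (b :* g) := b :* (a :* g) :+ d :* (s :* b :* g))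
             refl (φ' s) s δ (newton i s) (g' s) ⟩
      newton i s * (φ' s * g' s) + δ * (s * newton i s * g' s)
        ≡⟨ cong (λ a → newton i s * (φ' s * g' s) + δ * (a * g' s)) (newton-suc i s) ⟩
      newton i s * (φ' s * g' s) + δ * ((newton (suc i) s + node i * newton i s) * g' s)
        ≡⟨ cong (newton i s * (φ' s * g' s) +_)
             (solve 5 (λ d b n a g → d :* ((b :+ n :* a) :* g) := d :* (b :* g) :+ d :* n :* (a :* g))
               refl δ (newton (suc i) s) (node i) (newton i s) (g' s)) ⟩
      newton i s * (φ' s * g' s) +
        (δ * (newton (suc i) s * g' s) + δ * node i * (newton i s * g' s)) ∎

  -- A budget argument: each affine factor is paid for by an order of g, by raising i, or not at
  -- all. The total M + q covers the M orders of g and the q weights of degree below q, whose sums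
  -- over F_p vanish.
  orth-smear : ∀ N {M i m} v (g : V m → F) → N ℕ.+ i ℕ.≤ M ℕ.+ q → Orth M g → Orth N (smear i v g)
  orth-smear zero    v g _  _ = tt
  orth-smear (suc N) {M} {i} v g le o = total M le o , λ φ aff →
    orth-cong N (λ x → sym (smear-affine i v g φ aff x))
      (orth-+ N (multiplied φ aff M le o)
        (orth-+ N (orth-*ˡ N _ (orth-smear N v g (ℕₚ.≤-trans (ℕₚ.≤-reflexive (ℕₚ.+-suc N i)) le) o))
                  (orth-*ˡ N _ (orth-smear N v g (ℕₚ.≤-trans (ℕₚ.n≤1+n _) le) o))))
    where
    multiplied : ∀ φ → Affine φ → ∀ M → suc N ℕ.+ i ℕ.≤ M ℕ.+ q → Orth M g →
                 Orth N (smear i v (λ y → φ y * g y))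
    multiplied φ aff zero    le _       = orth-smear N {0} v (λ y → φ y * g y) (ℕₚ.≤-trans (ℕₚ.n≤1+n _) le) tt
    multiplied φ aff (suc M) le (_ , o) = orth-smear N v (λ y → φ y * g y) (ℕₚ.≤-pred le) (o φ aff)
    total : ∀ M → suc N ℕ.+ i ℕ.≤ M ℕ.+ q → Orth M g → S.ΣV (smear i v g) ≡ 0#
    total (suc M) _  (Σg≡0 , _) =
      trans (ΣV-smear i v g) (trans (cong (S.sum (newton i) *_) Σg≡0) (zeroʳ _))
    -- With no order of g left, the budget forces i < q, so the weight itself sums to zero.
    total zero    le _          = trans (ΣV-smear i v g)
      (trans (cong (_* S.ΣV g) (newton-sum i (ℕₚ.≤-trans (s≤s (ℕₚ.m≤n+m i N)) le))) (zeroˡ _))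

  spread : ∀ {m} → V m → (V m → F) → V m → F
  spread v g x = S.sum (λ s → g (x ⊕ (- s) ⊙ v))

  -- The constant weight, i = 0, leaves the whole budget: a cylinder gains q orders over its base.
  orth-spread : ∀ N {m} v (g : V m → F) → Orth N g → Orth (q ℕ.+ N) (spread v g)
  orth-spread N v g o = orth-cong (q ℕ.+ N)
    (λ x → S.sum-cong (λ s → trans (cong (_* g (x ⊕ (- s) ⊙ v)) (newton-zero s)) (*-identityˡ _)))
    (orth-smear (q ℕ.+ N) {N} {0} v g
      (ℕₚ.≤-reflexive (trans (ℕₚ.+-identityʳ _) (ℕₚ.+-comm q N))) o)

-- Finite sums of natural numbers: minima, averages, counting by a predicate

module NatSum where
  open import Algebra.Properties.CommutativeMonoid.Sum ℕₚ.+-0-commutativeMonoid using (sum; sum-remove)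

  sum-mono : ∀ {k} {f g : Fin k → ℕ} → (∀ i → f i ≤ g i) → sum f ≤ sum g
  sum-mono {zero}  f≤g = z≤n
  sum-mono {suc k} f≤g = ℕₚ.+-mono-≤ (f≤g zero) (sum-mono (f≤g ∘ suc))

  sum-const : ∀ k a → sum {k} (λ _ → a) ≡ k ℕ.* a
  sum-const zero    a = refl
  sum-const (suc k) a = cong (a ℕ.+_) (sum-const k a)

  term≤sum : ∀ {k} (f : Fin k → ℕ) i → f i ≤ sum f
  term≤sum f zero    = ℕₚ.m≤m+n _ _
  term≤sum f (suc i) = ℕₚ.≤-trans (term≤sum (f ∘ suc) i) (ℕₚ.m≤n+m _ _)

  two-terms≤sum : ∀ {k} (f : Fin k → ℕ) {i j} → i ≢ j → f i ℕ.+ f j ≤ sum f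
  two-terms≤sum f {zero}  {zero}  i≢j = contradiction refl i≢j
  two-terms≤sum f {zero}  {suc j} i≢j = ℕₚ.+-monoʳ-≤ (f zero) (term≤sum (f ∘ suc) j)
  two-terms≤sum f {suc i} {zero}  i≢j = ℕₚ.≤-trans (ℕₚ.≤-reflexive (ℕₚ.+-comm (f (suc i)) _))
    (ℕₚ.+-monoʳ-≤ (f zero) (term≤sum (f ∘ suc) i))
  two-terms≤sum f {suc i} {suc j} i≢j =
    ℕₚ.≤-trans (two-terms≤sum (f ∘ suc) (i≢j ∘ cong suc)) (ℕₚ.m≤n+m _ _)

  sum-positive : ∀ {k} (f : Fin k → ℕ) → 1 ≤ sum f → ∃ λ i → 1 ≤ f i
  sum-positive {suc k} f 1≤Σ with f zero in eq
  ... | suc _ = zero , subst (1 ≤_) (sym eq) (s≤s z≤n)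
  ... | zero with sum-positive (f ∘ suc) 1≤Σ
  ...   | i , 1≤fi = suc i , 1≤fi

  sum-*ˡ : ∀ {k} a (f : Fin k → ℕ) → sum (λ i → a ℕ.* f i) ≡ a ℕ.* sum f
  sum-*ˡ {zero}  a f = sym (ℕₚ.*-zeroʳ a)
  sum-*ˡ {suc k} a f = trans (cong (a ℕ.* f zero ℕ.+_) (sum-*ˡ a (f ∘ suc)))
                             (sym (ℕₚ.*-distribˡ-+ a (f zero) _))

  sum-min : ∀ {k} (f : Fin k → ℕ) → Fin k → ∃ λ i → k ℕ.* f i ≤ sum f
  sum-min {suc zero}    f _ = zero , ℕₚ.≤-refl
  sum-min {suc (suc k)} f _ with sum-min (f ∘ suc) zero
  ... | i , min with ℕₚ.≤-total (f zero) (f (suc i))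
  ...   | inj₁ f0≤fi = zero , ℕₚ.+-monoʳ-≤ (f zero) (ℕₚ.≤-trans (ℕₚ.*-monoʳ-≤ (suc k) f0≤fi) min)
  ...   | inj₂ fi≤f0 = suc i , ℕₚ.+-mono-≤ fi≤f0 min

  sum-except : ∀ {k q} (f : Fin k → ℕ) i b → k ≡ suc q → (∀ j → j ≢ i → f j ≡ b) →
               sum f ≡ f i ℕ.+ q ℕ.* b
  sum-except {q = q} f i b refl f≡b = trans (sum-remove {i = i} f) (cong (f i ℕ.+_)
    (trans (sum-cong-≗ (λ j → f≡b _ (punchInᵢ≢i i j))) (sum-const q b)))
    where open import Algebra.Properties.CommutativeMonoid.Sum ℕₚ.+-0-commutativeMonoid using (sum-cong-≗)

  -- Serves to count over slices: with a = 0 only the nonempty slices contribute, and in the cone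
  -- step the slices without difference contribute as well.
  sum-filter : ∀ {ℓ} {A : Set} {P : Pred A ℓ} (P? : Decidable P) (g : A → ℕ) a b →
               (∀ t → P t → b ≤ g t) → (∀ t → ¬ P t → a ≤ g t) →
               ∀ {k} (h : Fin k → A) →
               ∃ λ s → length (filter P? (tabulate h)) ℕ.+ s ≡ k ×
                       length (filter P? (tabulate h)) ℕ.* b ℕ.+ s ℕ.* a ≤ sum (g ∘ h)
  sum-filter P? g a b b≤ a≤ {zero}  h = 0 , refl , z≤n
  sum-filter P? g a b b≤ a≤ {suc k} h with sum-filter P? g a b b≤ a≤ (h ∘ suc) | P? (h zero)
  ... | s , u+s≡k , bound | yes Ph = s , cong suc u+s≡k ,
    ℕₚ.≤-trans (ℕₚ.≤-reflexive (ℕₚ.+-assoc b _ _)) (ℕₚ.+-mono-≤ (b≤ _ Ph) bound)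
  ... | s , u+s≡k , bound | no ¬Ph = suc s , trans (ℕₚ.+-suc _ s) (cong suc u+s≡k) ,
    ℕₚ.≤-trans (ℕₚ.≤-reflexive (solve 3 (λ u s a → u :+ (a :+ s) := a :+ (u :+ s)) refl
      (length (filter P? (tabulate (h ∘ suc))) ℕ.* b) (s ℕ.* a) a)) (ℕₚ.+-mono-≤ (a≤ _ ¬Ph) bound)
    where open +-*-Solver

-- Numbers of nonzero values, homogeneous functions and averaging over hyperplanes

module Weights {p q : ℕ} (K : PrimeField p q) where
  open PrimeField K
  open LinearAlgebra K
  open Orthogonality K
  open Reindex ℕₚ.+-0-commutativeMonoid
  open NatSum

  p≥1 : 1 ≤ p
  p≥1 = subst (1 ≤_) (sym p≡1+q) (s≤s z≤n)

  instance
    p-nonZero : ℕ.NonZero p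
    p-nonZero = ℕ.>-nonZero p≥1

  ΣV-mono : ∀ {m} {f g : V m → ℕ} → (∀ x → f x ≤ g x) → C.ΣV f ≤ C.ΣV g
  ΣV-mono {zero}  f≤g = f≤g []
  ΣV-mono {suc m} f≤g = sum-mono (λ t → ΣV-mono (λ x → f≤g (t ∷ x)))

  ΣV-const : ∀ m a → C.ΣV {m} (λ _ → a) ≡ p ^ m ℕ.* a
  ΣV-const zero    a = sym (ℕₚ.+-identityʳ a)
  ΣV-const (suc m) a = trans (C.sum-cong {p} (λ _ → ΣV-const m a))
    (trans (sum-const p _) (sym (ℕₚ.*-assoc p (p ^ m) a)))

  ΣV-*ˡ′ : ∀ {m} a (f : V m → ℕ) → C.ΣV (λ x → a ℕ.* f x) ≡ a ℕ.* C.ΣV f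
  ΣV-*ˡ′ {zero}  a f = refl
  ΣV-*ˡ′ {suc m} a f = trans (C.sum-cong (λ t → ΣV-*ˡ′ a (λ x → f (t ∷ x))))
                             (sum-*ˡ a (λ t → C.ΣV (λ x → f (t ∷ x))))

  ΣV-min : ∀ {m} (f : V m → ℕ) → ∃ λ x → p ^ m ℕ.* f x ≤ C.ΣV f
  ΣV-min {zero}  f = [] , ℕₚ.≤-reflexive (ℕₚ.+-identityʳ (f []))
  ΣV-min {suc m} f with sum-min (λ t → C.ΣV (λ x → f (t ∷ x))) 0#
  ... | t , min-t with ΣV-min (λ x → f (t ∷ x))
  ...   | x , min-x = t ∷ x , ℕₚ.≤-trans (ℕₚ.≤-reflexive (ℕₚ.*-assoc p (p ^ m) _))
                                (ℕₚ.≤-trans (ℕₚ.*-monoʳ-≤ p min-x) min-t)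

  nz : F → ℕ
  nz a = if does (a ≟ 0#) then 0 else 1

  nz-nonzero : ∀ {a} → a ≢ 0# → nz a ≡ 1
  nz-nonzero {a} a≢0 with a ≟ 0#
  ... | yes a≡0 = contradiction a≡0 a≢0
  ... | no  _   = refl

  nz-zero : ∀ {a} → a ≡ 0# → nz a ≡ 0
  nz-zero {a} a≡0 with a ≟ 0#
  ... | yes _   = refl
  ... | no  a≢0 = contradiction a≡0 a≢0

  nz-positive : ∀ {a} → 1 ≤ nz a → a ≢ 0#
  nz-positive 1≤nz refl with nz 0# | nz-zero {0#} refl
  nz-positive () refl | _ | refl

  nz≤1 : ∀ a → nz a ≤ 1
  nz≤1 a with a ≟ 0#
  ... | yes _ = z≤n
  ... | no  _ = s≤s z≤n

  nz-difference : ∀ a b → nz (a + - b) ≤ nz a ℕ.+ nz b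
  nz-difference a b with a ≟ 0# | b ≟ 0#
  ... | no  _    | _        = ℕₚ.≤-trans (nz≤1 (a + - b)) (s≤s z≤n)
  ... | yes _    | no  _    = nz≤1 (a + - b)
  ... | yes refl | yes refl = ℕₚ.≤-reflexive (nz-zero (-‿inverseʳ 0#))

  nz-⇔ : ∀ {a b} → (a ≢ 0# → b ≢ 0#) → (b ≢ 0# → a ≢ 0#) → nz a ≡ nz b
  nz-⇔ {a} {b} a→b b→a with a ≟ 0# | b ≟ 0#
  ... | yes _   | yes _   = refl
  ... | no  _   | no  _   = refl
  ... | yes a≡0 | no  b≢0 = contradiction a≡0 (b→a b≢0)
  ... | no  a≢0 | yes b≡0 = contradiction b≡0 (a→b a≢0)

  weight : ∀ {m} → (V m → F) → ℕ
  weight f = C.ΣV (λ x → nz (f x))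

  weight-cong : ∀ {m} {f g : V m → F} → (∀ x → f x ≡ g x) → weight f ≡ weight g
  weight-cong f≡g = C.ΣV-cong (λ x → cong nz (f≡g x))

  weight-positive : ∀ {m} (f : V m → F) x → f x ≢ 0# → 1 ≤ weight f
  weight-positive f []      fx≢0 = ℕₚ.≤-reflexive (sym (nz-nonzero fx≢0))
  weight-positive f (t ∷ x) fx≢0 = ℕₚ.≤-trans (weight-positive (λ y → f (t ∷ y)) x fx≢0)
                                     (term≤sum (λ s → weight (λ y → f (s ∷ y))) t)

  weight-witness : ∀ {m} (f : V m → F) → 1 ≤ weight f → ∃ λ x → f x ≢ 0#
  weight-witness {zero}  f 1≤w = [] , nz-positive 1≤w
  weight-witness {suc m} f 1≤w with sum-positive _ 1≤w
  ... | t , 1≤wt with weight-witness (λ x → f (t ∷ x)) 1≤wt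
  ...   | x , fx≢0 = t ∷ x , fx≢0

  weight-zero : ∀ {m} (f : V m → F) → weight f ≡ 0 → ∀ x → f x ≡ 0#
  weight-zero f w≡0 x with f x ≟ 0#
  ... | yes fx≡0 = fx≡0
  ... | no  fx≢0 = contradiction (subst (1 ≤_) w≡0 (weight-positive f x fx≢0)) λ()

  zero-weight : ∀ {m} (f : V m → F) → (∀ x → f x ≡ 0#) → weight f ≡ 0
  zero-weight f f≡0 = C.ΣV-zero (λ x → nz-zero (f≡0 x))

  weight-unique : ∀ {m} (f : V m → F) → weight f ≤ 1 → ∀ {x y} → f x ≢ 0# → f y ≢ 0# → x ≡ y
  weight-unique f w≤1 {[]}    {[]}    fx≢0 fy≢0 = refl
  weight-unique f w≤1 {t ∷ x} {s ∷ y} fx≢0 fy≢0 with t ≟ s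
  ... | yes refl = cong (t ∷_) (weight-unique (λ z → f (t ∷ z))
    (ℕₚ.≤-trans (term≤sum (λ s → weight (λ z → f (s ∷ z))) t) w≤1) fx≢0 fy≢0)
  ... | no t≢s = contradiction (ℕₚ.≤-trans
    (ℕₚ.+-mono-≤ (weight-positive (λ z → f (t ∷ z)) x fx≢0) (weight-positive (λ z → f (s ∷ z)) y fy≢0))
    (ℕₚ.≤-trans (two-terms≤sum (λ s → weight (λ z → f (s ∷ z))) t≢s) w≤1)) λ { (s≤s ()) }

  weight-difference : ∀ {m} (f g : V m → F) → weight (λ x → f x + - g x) ≤ weight f ℕ.+ weight g
  weight-difference f g = ℕₚ.≤-trans (ΣV-mono (λ x → nz-difference (f x) (g x)))
                                     (ℕₚ.≤-reflexive (C.ΣV-∙ (λ x → nz (f x)) (λ x → nz (g x))))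

  weight-fibres : ∀ {m} (φ : V m → F) f → C.sum (λ t → weight (restrict φ t f)) ≡ weight f
  weight-fibres φ f = C.ΣV-fibres _ (λ t x → nz (restrict φ t f x)) φ
    (λ x → cong nz (restrict-on φ (φ x) f refl))
    (λ t x t≢φx → nz-zero (restrict-off φ t f (t≢φx ∘ sym)))

  Homogeneous : ∀ {m} → (V m → F) → Set
  Homogeneous f = ∀ s x → s ≢ 0# → f (s ⊙ x) ≡ f x

  -- Scaling by t carries the slice l = 1 onto the slice l = t, so the q slices off the hyperplane
  -- weigh the same.
  weight-homogeneous : ∀ {m} {f : V m → F} → Homogeneous f → ∀ l →
    weight f ≡ weight (restrict (dot l) 0# f) ℕ.+ q ℕ.* weight (restrict (dot l) 1# f)
  weight-homogeneous {f = f} hom l = trans (sym (weight-fibres (dot l) f))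
    (sum-except (λ t → weight (restrict (dot l) t f)) 0# _ p≡1+q rescale)
    where
    rescale : ∀ t → t ≢ 0# → weight (restrict (dot l) t f) ≡ weight (restrict (dot l) 1# f)
    rescale t t≢0 with inverse t t≢0
    ... | r , rt≡1 = trans (sym (ΣV-scale (λ x → nz (restrict (dot l) t f x)) t t≢0))
                           (weight-cong pointwise)
      where
      pointwise : ∀ x → restrict (dot l) t f (t ⊙ x) ≡ restrict (dot l) 1# f x
      pointwise x with dot l x ≟ 1#
      ... | yes lx≡1 = trans (restrict-on (dot l) t f
        (trans (dot-⊙ l t x) (trans (cong (t *_) lx≡1) (*-identityʳ t)))) (hom t x t≢0)
      ... | no lx≢1 = restrict-off (dot l) t f λ ltx≡t → lx≢1 (begin
        dot l x           ≡⟨ *-identityˡ _ ⟨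
        1# * dot l x      ≡⟨ cong (_* dot l x) rt≡1 ⟨
        r * t * dot l x   ≡⟨ *-assoc r t _ ⟩
        r * (t * dot l x) ≡⟨ cong (r *_) (trans (sym (dot-⊙ l t x)) ltx≡t) ⟩
        r * t             ≡⟨ rt≡1 ⟩
        1#                ∎)
        where open ≡-Reasoning

  when : ∀ {P : Set} → Dec P → ℕ → ℕ
  when P? a = if does P? then a else 0

  -- Translation by multiples of u preserves g and permutes the slices of l transitively.
  equidistribution : ∀ {m} (l u : V m) (g : V m → ℕ) → dot l u ≡ 1# →
    (∀ s x → g (x ⊕ s ⊙ u) ≡ g x) → ∀ t →
    p ℕ.* C.ΣV (λ x → when (dot l x ≟ t) (g x)) ≡ C.ΣV g
  equidistribution l u g lu≡1 inv t = begin
    p ℕ.* C.ΣV (λ x → when (dot l x ≟ t) (g x))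
      ≡⟨ sum-const p _ ⟨
    C.sum {p} (λ _ → C.ΣV (λ x → when (dot l x ≟ t) (g x)))
      ≡⟨ C.sum-cong shifted ⟨
    C.sum (λ s → C.ΣV (λ x → when (dot l x ≟ s) (g x)))
      ≡⟨ C.ΣV-fibres g (λ s x → when (dot l x ≟ s) (g x)) (dot l) on off ⟩
    C.ΣV g ∎
    where
    open ≡-Reasoning
    on : ∀ x → when (dot l x ≟ dot l x) (g x) ≡ g x
    on x with dot l x ≟ dot l x
    ... | yes _ = refl
    ... | no ≢  = contradiction refl ≢
    off : ∀ s x → s ≢ dot l x → when (dot l x ≟ s) (g x) ≡ 0
    off s x s≢ with dot l x ≟ s
    ... | yes ≡s = contradiction (sym ≡s) s≢
    ... | no  _  = refl
    shift : ∀ s x → dot l (x ⊕ (s + - t) ⊙ u) ≡ dot l x + (s + - t)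
    shift s x = trans (dot-⊕-⊙ l x _ u)
      (cong (dot l x +_) (trans (cong ((s + - t) *_) lu≡1) (*-identityʳ _)))
    pointwise : ∀ s x → when (dot l (x ⊕ (s + - t) ⊙ u) ≟ s) (g (x ⊕ (s + - t) ⊙ u))
                        ≡ when (dot l x ≟ t) (g x)
    pointwise s x with dot l (x ⊕ (s + - t) ⊙ u) ≟ s | dot l x ≟ t
    ... | yes _  | yes _  = inv _ x
    ... | no  _  | no  _  = refl
    ... | no  ≢s | yes ≡t = contradiction (trans (shift s x)
      (trans (cong (_+ (s + - t)) ≡t) (trans (+-comm t _) (inverse-+-cancel s t)))) ≢s
    ... | yes ≡s | no  ≢t = contradiction (begin
      dot l x                               ≡⟨ +-inverse-cancel (dot l x) (s + - t) ⟨
      dot l x + (s + - t) + - (s + - t)     ≡⟨ cong (_+ - (s + - t)) (trans (sym (shift s x)) ≡s) ⟩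
      s + - (s + - t)                       ≡⟨ cong (_+ - (s + - t)) (trans (+-comm t _) (inverse-+-cancel s t)) ⟨
      t + (s + - t) + - (s + - t)           ≡⟨ +-inverse-cancel t (s + - t) ⟩
      t                                     ∎) ≢t
    shifted : ∀ s → C.ΣV (λ x → when (dot l x ≟ s) (g x)) ≡ C.ΣV (λ x → when (dot l x ≟ t) (g x))
    shifted s = trans (sym (ΣV-translate (λ x → when (dot l x ≟ s) (g x)) ((s + - t) ⊙ u)))
                      (C.ΣV-cong (pointwise s))

  nz-restrict : ∀ {m} (φ : V m → F) t f x → nz (restrict φ t f x) ≡ when (φ x ≟ t) (nz (f x))
  nz-restrict φ t f x with φ x ≟ t
  ... | yes _ = refl
  ... | no  _ = nz-zero refl

  restrict-𝟎 : ∀ {m} (l : V m) f → restrict (dot l) 0# f 𝟎 ≡ f 𝟎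
  restrict-𝟎 l f = restrict-on (dot l) 0# f (dot-𝟎 l)

  -- Averaging over all linear forms, the zero form included: it never attains the bound.
  light-hyperplane : ∀ {m} {f : V m → F} → Homogeneous f → nz (f 𝟎) < weight f →
    ∃ λ l → p ℕ.* weight (restrict (dot l) 0# f) ≤ weight f ℕ.+ q ℕ.* nz (f 𝟎) ×
            1 ≤ weight (restrict (dot l) 1# f)
  light-hyperplane {m} {f} hom nz<w = l , light , positive
    where
    w₀ : V m → ℕ
    w₀ l = weight (restrict (dot l) 0# f)
    incident : V m → V m → ℕ
    incident l x = when (dot l x ≟ 0#) (nz (f x))
    -- A nonzero x lies on one p-th of the p^m hyperplanes, the origin on all of them; this is the
    -- surplus of the origin after multiplication by p.
    extra : V m → ℕ
    extra x = when (≡-dec _≟_ x 𝟎) (p ^ m ℕ.* (q ℕ.* nz (f x)))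
    perPoint : ∀ x → p ℕ.* C.ΣV (λ l → incident l x) ≡ p ^ m ℕ.* nz (f x) ℕ.+ extra x
    perPoint x with ≡-dec _≟_ x 𝟎
    ... | yes refl = begin
      p ℕ.* C.ΣV (λ l → incident l 𝟎)   ≡⟨ cong (p ℕ.*_) (C.ΣV-cong at-𝟎) ⟩
      p ℕ.* C.ΣV {m} (λ l → nz (f 𝟎))       ≡⟨ cong (p ℕ.*_) (ΣV-const m (nz (f 𝟎))) ⟩
      p ℕ.* (p ^ m ℕ.* nz (f 𝟎))        ≡⟨ cong (ℕ._* (p ^ m ℕ.* nz (f 𝟎))) p≡1+q ⟩
      suc q ℕ.* (p ^ m ℕ.* nz (f 𝟎))
        ≡⟨ solve 3 (λ q P a → (con 1 :+ q) :* (P :* a) := P :* a :+ P :* (q :* a)) refl q (p ^ m) (nz (f 𝟎)) ⟩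
      p ^ m ℕ.* nz (f 𝟎) ℕ.+ p ^ m ℕ.* (q ℕ.* nz (f 𝟎)) ∎
      where
      open ≡-Reasoning
      open +-*-Solver
      at-𝟎 : ∀ l → incident l 𝟎 ≡ nz (f 𝟎)
      at-𝟎 l = trans (sym (nz-restrict (dot l) 0# f 𝟎)) (cong nz (restrict-𝟎 l f))
    ... | no x≢𝟎 with dual-vector x x≢𝟎
    ...   | e , ex≡1 = begin
      p ℕ.* C.ΣV (λ l → incident l x)
        ≡⟨ cong (p ℕ.*_) (C.ΣV-cong (λ l → cong (λ a → when (a ≟ 0#) (nz (f x))) (dot-comm l x))) ⟩
      p ℕ.* C.ΣV (λ l → when (dot x l ≟ 0#) (nz (f x)))
        ≡⟨ equidistribution x e (λ _ → nz (f x)) (trans (dot-comm x e) ex≡1) (λ _ _ → refl) 0# ⟩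
      C.ΣV {m} (λ _ → nz (f x))
        ≡⟨ ΣV-const m _ ⟩
      p ^ m ℕ.* nz (f x)
        ≡⟨ ℕₚ.+-identityʳ _ ⟨
      p ^ m ℕ.* nz (f x) ℕ.+ 0 ∎
      where open ≡-Reasoning
    extra-𝟎 : extra 𝟎 ≡ p ^ m ℕ.* (q ℕ.* nz (f 𝟎))
    extra-𝟎 with ≡-dec _≟_ (𝟎 {m}) 𝟎
    ... | yes _ = refl
    ... | no ≢  = contradiction refl ≢
    extra-off : ∀ x → x ≢ 𝟎 → extra x ≡ 0
    extra-off x x≢𝟎 with ≡-dec _≟_ x 𝟎
    ... | yes ≡𝟎 = contradiction ≡𝟎 x≢𝟎
    ... | no _   = refl
    total : C.ΣV (λ l → p ℕ.* w₀ l) ≡ p ^ m ℕ.* (weight f ℕ.+ q ℕ.* nz (f 𝟎))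
    total = begin
      C.ΣV (λ l → p ℕ.* w₀ l)
        ≡⟨ ΣV-*ˡ′ p w₀ ⟩
      p ℕ.* C.ΣV w₀
        ≡⟨ cong (p ℕ.*_) (C.ΣV-cong (λ l → C.ΣV-cong (nz-restrict (dot l) 0# f))) ⟩
      p ℕ.* C.ΣV (λ l → C.ΣV (incident l))
        ≡⟨ cong (p ℕ.*_) (C.ΣV-comm incident) ⟩
      p ℕ.* C.ΣV (λ x → C.ΣV (λ l → incident l x))
        ≡⟨ ΣV-*ˡ′ p (λ x → C.ΣV (λ l → incident l x)) ⟨
      C.ΣV (λ x → p ℕ.* C.ΣV (λ l → incident l x))
        ≡⟨ C.ΣV-cong perPoint ⟩
      C.ΣV (λ x → p ^ m ℕ.* nz (f x) ℕ.+ extra x)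
        ≡⟨ C.ΣV-∙ (λ x → p ^ m ℕ.* nz (f x)) extra ⟩
      C.ΣV (λ x → p ^ m ℕ.* nz (f x)) ℕ.+ C.ΣV extra
        ≡⟨ cong₂ ℕ._+_ (ΣV-*ˡ′ (p ^ m) (λ x → nz (f x)))
                       (trans (C.ΣV-single extra 𝟎 extra-off) extra-𝟎) ⟩
      p ^ m ℕ.* weight f ℕ.+ p ^ m ℕ.* (q ℕ.* nz (f 𝟎))
        ≡⟨ ℕₚ.*-distribˡ-+ (p ^ m) (weight f) _ ⟨
      p ^ m ℕ.* (weight f ℕ.+ q ℕ.* nz (f 𝟎)) ∎
      where open ≡-Reasoning
    minimiser = ΣV-min (λ l → p ℕ.* w₀ l)
    l = proj₁ minimiser
    light : p ℕ.* w₀ l ≤ weight f ℕ.+ q ℕ.* nz (f 𝟎)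
    light = ℕₚ.*-cancelˡ-≤ (p ^ m) {{ℕₚ.m^n≢0 p m}}
      (ℕₚ.≤-trans (proj₂ minimiser) (ℕₚ.≤-reflexive total))
    positive : 1 ≤ weight (restrict (dot l) 1# f)
    positive with weight (restrict (dot l) 1# f) in eq
    ... | suc _ = s≤s z≤n
    -- An empty slice l = 1 would put the whole support on l = 0; the bound `light` would then say
    -- that p copies of the weight are at most the weight plus q times `nz (f 𝟎)`, which is too
    -- little.
    ... | zero  = contradiction (begin-strict
      weight f ℕ.+ q ℕ.* nz (f 𝟎)
        <⟨ ℕₚ.+-monoʳ-< (weight f) (ℕₚ.*-monoʳ-< q {{ℕ.>-nonZero 1≤q}} nz<w) ⟩
      suc q ℕ.* weight f        ≡⟨ cong (ℕ._* weight f) p≡1+q ⟨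
      p ℕ.* weight f            ≡⟨ cong (p ℕ.*_) (trans (weight-homogeneous hom l)
                                    (trans (cong (λ e → w₀ l ℕ.+ q ℕ.* e) eq)
                                    (trans (cong (w₀ l ℕ.+_) (ℕₚ.*-zeroʳ q)) (ℕₚ.+-identityʳ _)))) ⟩
      p ℕ.* w₀ l                ≤⟨ light ⟩
      weight f ℕ.+ q ℕ.* nz (f 𝟎) ∎) (ℕₚ.<-irrefl refl)
      where open ℕₚ.≤-Reasoning

-- The slice bound: minimum weight of a function of given order

module MinimumWeight {p q : ℕ} (K : PrimeField p q) where
  open PrimeField K
  open LinearAlgebra K
  open Orthogonality K
  open Weights K
  open NatSum using (sum-filter)

  length-allFin : length (allFin p) ≤ suc q
  length-allFin = ℕₚ.≤-reflexive (trans (length-tabulate {n = p} (λ i → i)) p≡1+q)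

  orth-restrict : ∀ {N m} {f φ : V m → F} t → Affine φ → Orth (q ℕ.+ N) f → Orth N (restrict φ t f)
  orth-restrict t aff = orth-slice (allFin p) aff (λ x _ → ∈-allFin _) (∈-allFin t) length-allFin

  support-list : ∀ {m} (φ : V m → F) (f : V m → F) → List F
  support-list φ f = filter (λ t → 1 ℕ.≤? weight (restrict φ t f)) (allFin p)

  support-list-complete : ∀ {m} (φ f : V m → F) x → f x ≢ 0# → φ x ∈ support-list φ f
  support-list-complete φ f x fx≢0 = ∈-filter⁺ (λ t → 1 ℕ.≤? weight (restrict φ t f)) (∈-allFin (φ x))
    (weight-positive (restrict φ (φ x) f) x (fx≢0 ∘ trans (sym (restrict-on φ (φ x) f refl))))

  orth-support-slice : ∀ {d N m} (f φ : V m → F) t → Affine φ →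
    length (support-list φ f) ≤ suc d → 1 ≤ weight (restrict φ t f) →
    Orth (d ℕ.+ N) f → Orth N (restrict φ t f)
  orth-support-slice f φ t aff |L|≤ 1≤wt = orth-slice (support-list φ f) aff
    (support-list-complete φ f) (∈-filter⁺ _ (∈-allFin t) 1≤wt) |L|≤

  head-form : ∀ {m} → V (suc m)
  head-form = 1# ∷ 𝟎

  head-form-head : ∀ {m} t (x : V m) → dot head-form (t ∷ x) ≡ t
  head-form-head t x = trans (cong₂ _+_ (*-identityˡ t) (dot-𝟎ˡ x)) (+-identityʳ t)

  weight-head-slice : ∀ {m} (f : V (suc m) → F) t →
    weight (restrict (dot head-form) t f) ≡ weight (λ x → restrict (dot head-form) t f (t ∷ x))
  weight-head-slice f t = C.sum-single (λ s → weight (λ x → restrict (dot head-form) t f (s ∷ x))) t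
    (λ s s≢t → zero-weight (λ x → restrict (dot head-form) t f (s ∷ x)) (λ x →
      restrict-off (dot head-form) t f {s ∷ x} (s≢t ∘ trans (sym (head-form-head s x)))))

  support-list-bound : ∀ {m} (φ f : V m → F) b →
    (∀ t → 1 ≤ weight (restrict φ t f) → b ≤ weight (restrict φ t f)) →
    length (support-list φ f) ℕ.* b ≤ weight f
  support-list-bound φ f b b≤ with sum-filter (λ t → 1 ℕ.≤? weight (restrict φ t f))
    (λ t → weight (restrict φ t f)) 0 b b≤ (λ _ _ → z≤n) (λ t → t)
  ... | s , _ , bound = ℕₚ.≤-trans (ℕₚ.m≤m+n _ (s ℕ.* 0))
    (ℕₚ.≤-trans bound (ℕₚ.≤-reflexive (weight-fibres φ f)))

  support-list-length : ∀ {m} (φ f : V m → F) → length (support-list φ f) ≤ suc q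
  support-list-length φ f = ℕₚ.≤-trans (length-filter _ (allFin p)) length-allFin
    where open import Data.List.Properties using (length-filter)

  -- The minimum distance of generalized Reed-Muller codes, by induction on the dimension: if d + 1
  -- slices by the first coordinate are nonempty, each keeps all but d orders. Here j ranges over
  -- all naturals and not only over remainders modulo q; the cone step reaches j = q + 1.
  minimum-weight : ∀ {m} (f : V m → F) e j → Orth (e ℕ.* q ℕ.+ j) f →
                   ∀ x → f x ≢ 0# → suc j ℕ.* p ^ e ≤ weight f
  minimum-weight {zero} f e j o [] fx≢0 with e ℕ.* q ℕ.+ j in N≡ | o
  ... | suc _ | f≡0 , _ = contradiction f≡0 fx≢0
  -- On a single point a nonzero function has order zero, which forces e = j = 0.
  ... | zero  | _ with ℕₚ.m*n≡0⇒m≡0 e q {{ℕ.>-nonZero 1≤q}} (ℕₚ.m+n≡0⇒m≡0 (e ℕ.* q) N≡)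
                     | ℕₚ.m+n≡0⇒n≡0 (e ℕ.* q) N≡
  ...   | refl | refl = weight-positive f [] fx≢0
  minimum-weight {suc m} f e j o x fx≢0 with length (support-list (dot head-form) f) in |L|≡
  ... | zero  = contradiction (subst (1 ≤_) |L|≡ (∈-length (support-list-complete (dot head-form) f x fx≢0))) λ ()
  ... | suc d = by-slices (ℕₚ.≤-total d j)
    where
    φ = dot head-form
    d≤q : d ≤ q
    d≤q = ℕₚ.≤-pred (subst (_≤ suc q) |L|≡ (support-list-length φ f))
    slice-bound : ∀ {N} e′ j′ → e ℕ.* q ℕ.+ j ≡ d ℕ.+ N → N ≡ e′ ℕ.* q ℕ.+ j′ → ∀ t →
      1 ≤ weight (restrict φ t f) → suc j′ ℕ.* p ^ e′ ≤ weight (restrict φ t f)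
    slice-bound {N} e′ j′ eq refl t 1≤wt = subst (suc j′ ℕ.* p ^ e′ ≤_) (sym (weight-head-slice f t))
      (minimum-weight (λ y → restrict φ t f (t ∷ y)) e′ j′
        (orth-tail N (restrict φ t f) t
          (λ s y s≢t → restrict-off φ t f (s≢t ∘ trans (sym (head-form-head s y))))
          (orth-support-slice f φ t (dot-affine head-form) (ℕₚ.≤-reflexive |L|≡) 1≤wt
            (subst (λ M → Orth M f) eq o)))
        (proj₁ witness) (proj₂ witness))
      where witness = weight-witness (λ y → restrict φ t f (t ∷ y)) (subst (1 ≤_) (weight-head-slice f t) 1≤wt)
    total : ∀ b → (∀ t → 1 ≤ weight (restrict φ t f) → b ≤ weight (restrict φ t f)) →
            suc d ℕ.* b ≤ weight f
    total b b≤ = subst (λ u → u ℕ.* b ≤ weight f) |L|≡ (support-list-bound φ f b b≤)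
    open +-*-Solver
    by-slices : d ≤ j ⊎ j ≤ d → suc j ℕ.* p ^ e ≤ weight f
    -- The d lost orders come out of j = d + i, and (d + 1)(i + 1) exceeds j + 1 by d i.
    by-slices (inj₁ d≤j) with ℕₚ.m≤n⇒∃[o]m+o≡n d≤j
    ... | i , d+i≡j = ℕₚ.≤-trans
      (ℕₚ.≤-trans (ℕₚ.m≤m+n _ (d ℕ.* i ℕ.* p ^ e)) (ℕₚ.≤-reflexive
        (trans (cong (λ j → suc j ℕ.* p ^ e ℕ.+ d ℕ.* i ℕ.* p ^ e) (sym d+i≡j))
        (solve 3 (λ d i P → (con 1 :+ (d :+ i)) :* P :+ d :* i :* P := (con 1 :+ d) :* ((con 1 :+ i) :* P))
          refl d i (p ^ e)))))
      (total (suc i ℕ.* p ^ e) (slice-bound e i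
        (trans (cong (e ℕ.* q ℕ.+_) (sym d+i≡j))
          (solve 3 (λ E d i → E :+ (d :+ i) := d :+ (E :+ i)) refl (e ℕ.* q) d i)) refl))
    by-slices (inj₂ j≤d) = few-zero-slices e refl
      where
      few-zero-slices : ∀ e₀ → e ≡ e₀ → suc j ℕ.* p ^ e₀ ≤ weight f
      few-zero-slices zero _ = ℕₚ.≤-trans (ℕₚ.*-monoˡ-≤ 1 (s≤s j≤d)) (total 1 (λ _ 1≤wt → 1≤wt))
      -- Now d exceeds j, so one block of q = d + h orders is broken up and each slice keeps h + j
      -- beyond e′ blocks. Writing d = j + i gives p = 1 + j + i + h, and (d + 1)(h + j + 1) exceeds
      -- (j + 1) p by i h.
      few-zero-slices (suc e′) e≡ with ℕₚ.m≤n⇒∃[o]m+o≡n d≤q | ℕₚ.m≤n⇒∃[o]m+o≡n j≤d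
      ... | h , d+h≡q | i , j+i≡d = ℕₚ.≤-trans
        (ℕₚ.≤-trans (ℕₚ.m≤m+n _ (i ℕ.* h ℕ.* p ^ e′)) (ℕₚ.≤-reflexive (begin
          suc j ℕ.* (p ℕ.* p ^ e′) ℕ.+ i ℕ.* h ℕ.* p ^ e′
            ≡⟨ cong (λ r → suc j ℕ.* (r ℕ.* p ^ e′) ℕ.+ i ℕ.* h ℕ.* p ^ e′)
                 (trans p≡1+q (cong suc (trans (sym d+h≡q) (cong (ℕ._+ h) (sym j+i≡d))))) ⟩
          suc j ℕ.* (suc (j ℕ.+ i ℕ.+ h) ℕ.* p ^ e′) ℕ.+ i ℕ.* h ℕ.* p ^ e′
            ≡⟨ solve 4 (λ j i h P →
                 (con 1 :+ j) :* ((con 1 :+ (j :+ i :+ h)) :* P) :+ i :* h :* P :=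
                 (con 1 :+ (j :+ i)) :* ((con 1 :+ (h :+ j)) :* P)) refl j i h (p ^ e′) ⟩
          suc (j ℕ.+ i) ℕ.* (suc (h ℕ.+ j) ℕ.* p ^ e′)
            ≡⟨ cong (λ d → suc d ℕ.* (suc (h ℕ.+ j) ℕ.* p ^ e′)) j+i≡d ⟩
          suc d ℕ.* (suc (h ℕ.+ j) ℕ.* p ^ e′) ∎)))
        (total (suc (h ℕ.+ j) ℕ.* p ^ e′) (slice-bound e′ (h ℕ.+ j)
          (begin
            e ℕ.* q ℕ.+ j                       ≡⟨ cong (λ e → e ℕ.* q ℕ.+ j) e≡ ⟩
            q ℕ.+ e′ ℕ.* q ℕ.+ j                ≡⟨ cong (λ r → r ℕ.+ e′ ℕ.* q ℕ.+ j) (sym d+h≡q) ⟩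
            d ℕ.+ h ℕ.+ e′ ℕ.* q ℕ.+ j          ≡⟨ solve 4 (λ d h E j → d :+ h :+ E :+ j := d :+ (E :+ (h :+ j)))
                                                     refl d h (e′ ℕ.* q) j ⟩
            d ℕ.+ (e′ ℕ.* q ℕ.+ (h ℕ.+ j))      ∎) refl))
        where open ≡-Reasoning

-- Restriction to hyperplanes and the case f(0) = 0

module Hyperplanes {p q : ℕ} (K : PrimeField p q) where
  open PrimeField K
  open LinearAlgebra K
  open Orthogonality K
  open Weights K
  open MinimumWeight K

  restrict-homogeneous : ∀ {m} (l : V m) {f} → Homogeneous f → Homogeneous (restrict (dot l) 0# f)
  restrict-homogeneous l {f} hom s x s≢0 with dot l x ≟ 0#
  ... | yes lx≡0 = trans (restrict-on (dot l) 0# f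
    (trans (dot-⊙ l s x) (trans (cong (s *_) lx≡0) (zeroʳ s)))) (hom s x s≢0)
  ... | no lx≢0 = restrict-off (dot l) 0# f
    (λ lsx≡0 → *-nonzero s≢0 lx≢0 (trans (sym (dot-⊙ l s x)) lsx≡0))

  restrict-comm : ∀ {m} (φ ψ : V m → F) s t f x →
    restrict φ s (restrict ψ t f) x ≡ restrict ψ t (restrict φ s f) x
  restrict-comm φ ψ s t f x with φ x ≟ s | ψ x ≟ t
  ... | yes _ | yes _ = refl
  ... | yes _ | no  _ = refl
  ... | no  _ | yes _ = refl
  ... | no  _ | no  _ = refl

  restrict-difference : ∀ {m} (φ : V m → F) t f g x →
    restrict φ t (λ y → f y + - g y) x ≡ restrict φ t f x + - restrict φ t g x
  restrict-difference φ t f g x with φ x ≟ t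
  ... | yes _ = refl
  ... | no  _ = sym (-‿inverseʳ 0#)

  difference-zero : ∀ {a b} → a + - b ≡ 0# → a ≡ b
  difference-zero {a} {b} eq =
    trans (sym (inverse-+-cancel a b)) (trans (cong (_+ b) eq) (+-identityˡ b))

  -- Every vector off the hyperplane is a multiple of one in the chart l = 1.
  homogeneous-zero : ∀ {m} (l : V m) {f} → Homogeneous f → (∀ x → dot l x ≡ 0# → f x ≡ 0#) →
    weight (restrict (dot l) 1# f) ≡ 0 → ∀ x → f x ≡ 0#
  homogeneous-zero l {f} hom vanishes w≡0 x with dot l x ≟ 0#
  ... | yes lx≡0 = vanishes x lx≡0
  ... | no  lx≢0 with inverse (dot l x) lx≢0
  ...   | r , r*lx≡1 = trans (sym (hom r x r≢0))
    (trans (sym (restrict-on (dot l) 1# f (trans (dot-⊙ l r x) r*lx≡1)))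
           (weight-zero (restrict (dot l) 1# f) w≡0 (r ⊙ x)))
    where
    r≢0 : r ≢ 0#
    r≢0 refl = 1≢0 (trans (sym r*lx≡1) (zeroˡ _))

  -- The chart l = 1 costs only q - 1 orders when f vanishes at infinity.
  orth-chart : ∀ {N m} (l : V m) f → (∀ x → dot l x ≡ 0# → f x ≡ 0#) →
    Orth (q ℕ.+ N) f → Orth (suc N) (restrict (dot l) 1# f)
  orth-chart {N} l f vanishes o with ℕₚ.m≤n⇒∃[o]m+o≡n 1≤q
  ... | d , 1+d≡q = orth-slice L (dot-affine l)
    (λ x fx≢0 → ∈-filter⁺ ≢0? (∈-allFin (dot l x)) (fx≢0 ∘ vanishes x))
    (∈-filter⁺ ≢0? (∈-allFin 1#) 1≢0)
    (ℕₚ.≤-pred (ℕₚ.≤-trans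
      (filter-notAll ≢0? (allFin p) (Any.map (λ { refl 0≢0 → 0≢0 refl }) (∈-allFin 0#)))
      (subst (λ r → length (allFin p) ≤ suc r) (sym 1+d≡q) length-allFin)))
    (subst (λ M → Orth M f) (trans (cong (ℕ._+ N) (sym 1+d≡q)) (sym (ℕₚ.+-suc d N))) o)
    where
    ≢0? = λ t → ¬? (t ≟ 0#)
    L   = filter ≢0? (allFin p)

  2≤p : 2 ≤ p
  2≤p = subst (2 ≤_) (sym p≡1+q) (s≤s 1≤q)

  chart-positive : ∀ {m} {f : V m → F} → Homogeneous f → ∀ l →
    1 ≤ weight (restrict (dot l) 1# f) → weight (restrict (dot l) 0# f) ℕ.+ q ≤ weight f
  chart-positive hom l 1≤E = ℕₚ.≤-trans
    (ℕₚ.+-monoʳ-≤ _ (ℕₚ.≤-trans (ℕₚ.≤-reflexive (sym (ℕₚ.*-identityʳ q))) (ℕₚ.*-monoʳ-≤ q 1≤E)))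
    (ℕₚ.≤-reflexive (sym (weight-homogeneous hom l)))

  -- With f(0) = 0 the weight is q times the number of points, so the hypothesis says fewer than
  -- 2p^(k-1) points; the factor p on the left keeps it meaningful at k = 0, where the induction
  -- starts.
  light-vanishes : ∀ k {m} (f : V m → F) → Homogeneous f → Orth (k ℕ.* q) f → f 𝟎 ≡ 0# →
    p ℕ.* weight f < 2 ℕ.* (q ℕ.* p ^ k) → weight f ≡ 0
  light-vanishes k f hom o f𝟎≡0 light with weight f in w≡
  ... | zero  = refl
  ... | suc _ with light-hyperplane hom (subst (_< weight f) (sym (nz-zero f𝟎≡0)) (subst (1 ≤_) (sym w≡) (s≤s z≤n)))
  ...   | l , hyperplane-light , 1≤E = ⊥-elim (by-dimension k o light′)
    where
    open ℕₚ.≤-Reasoning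
    light′ : p ℕ.* weight f < 2 ℕ.* (q ℕ.* p ^ k)
    light′ = subst (λ w → p ℕ.* w < 2 ℕ.* (q ℕ.* p ^ k)) (sym w≡) light
    f₀ = restrict (dot l) 0# f
    f₁ = restrict (dot l) 1# f
    by-dimension : ∀ k → Orth (k ℕ.* q) f → p ℕ.* weight f < 2 ℕ.* (q ℕ.* p ^ k) → ⊥
    by-dimension zero    _ light = ℕₚ.<⇒≱ light (begin
      2 ℕ.* (q ℕ.* 1)   ≡⟨ cong (2 ℕ.*_) (ℕₚ.*-identityʳ q) ⟩
      2 ℕ.* q           ≤⟨ ℕₚ.*-mono-≤ 2≤p (ℕₚ.≤-trans (ℕₚ.m≤n+m q (weight f₀)) (chart-positive hom l 1≤E)) ⟩
      p ℕ.* weight f    ∎)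
    by-dimension (suc k) o light = ℕₚ.<⇒≱ light (begin
      2 ℕ.* (q ℕ.* (p ℕ.* p ^ k))
        ≡⟨ solve 3 (λ q p P → con 2 :* (q :* (p :* P)) := p :* (q :* (con 2 :* P))) refl q p (p ^ k) ⟩
      p ℕ.* (q ℕ.* (2 ℕ.* p ^ k))
        ≤⟨ ℕₚ.*-monoʳ-≤ p (ℕₚ.*-monoʳ-≤ q 2P≤E) ⟩
      p ℕ.* (q ℕ.* weight f₁)
        ≤⟨ ℕₚ.*-monoʳ-≤ p (ℕₚ.≤-trans (ℕₚ.m≤n+m _ (weight f₀))
             (ℕₚ.≤-reflexive (sym (weight-homogeneous hom l)))) ⟩
      p ℕ.* weight f ∎)
      where
      open +-*-Solver
      f₀-light : p ℕ.* weight f₀ < 2 ℕ.* (q ℕ.* p ^ k)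
      f₀-light = ℕₚ.*-cancelˡ-< p _ _ (begin-strict
        p ℕ.* (p ℕ.* weight f₀)
          ≤⟨ ℕₚ.*-monoʳ-≤ p hyperplane-light ⟩
        p ℕ.* (weight f ℕ.+ q ℕ.* nz (f 𝟎))
          ≡⟨ cong (λ a → p ℕ.* (weight f ℕ.+ q ℕ.* a)) (nz-zero f𝟎≡0) ⟩
        p ℕ.* (weight f ℕ.+ q ℕ.* 0)
          ≡⟨ cong (p ℕ.*_) (trans (cong (weight f ℕ.+_) (ℕₚ.*-zeroʳ q)) (ℕₚ.+-identityʳ _)) ⟩
        p ℕ.* weight f
          <⟨ light ⟩
        2 ℕ.* (q ℕ.* (p ℕ.* p ^ k))
          ≡⟨ solve 3 (λ q p P → con 2 :* (q :* (p :* P)) := p :* (con 2 :* (q :* P))) refl q p (p ^ k) ⟩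
        p ℕ.* (2 ℕ.* (q ℕ.* p ^ k)) ∎)
      f₀-zero : weight f₀ ≡ 0
      f₀-zero = light-vanishes k f₀ (restrict-homogeneous l hom)
        (orth-restrict 0# (dot-affine l) o) (trans (restrict-𝟎 l f) f𝟎≡0) f₀-light
      vanishes : ∀ x → dot l x ≡ 0# → f x ≡ 0#
      vanishes x lx≡0 = trans (sym (restrict-on (dot l) 0# f lx≡0)) (weight-zero f₀ f₀-zero x)
      -- Since f vanishes on l = 0, the chart keeps one order beyond k q; this is j = 1 in the slice
      -- bound.
      2P≤E : 2 ℕ.* p ^ k ≤ weight f₁
      2P≤E with weight-witness f₁ 1≤E
      ... | x , f₁x≢0 = minimum-weight f₁ k 1
        (subst (λ N → Orth N f₁) (sym (ℕₚ.+-comm (k ℕ.* q) 1)) (orth-chart l f vanishes o)) x f₁x≢0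

-- Functions supported on a subspace, and cones over them

module Flats {p q : ℕ} (K : PrimeField p q) where
  open PrimeField K
  open LinearAlgebra K
  open Orthogonality K
  open Weights K
  open MinimumWeight K
  open Hyperplanes K
  open Reindex ℕₚ.+-0-commutativeMonoid

  -- With homogeneity, the support is a linear subspace.
  record Flat {m} (f : V m → F) : Set where
    field
      ⊕-closed : ∀ x y → f x ≢ 0# → f y ≢ 0# → f (x ⊕ y) ≢ 0#
      constant : ∀ x → f x ≢ 0# → f x ≡ f 𝟎

  -- The support is closed under adding multiples of u, so `equidistribution` applies.
  flat-slices : ∀ {m} {h : V m → F} → Homogeneous h → Flat h → h 𝟎 ≢ 0# →
    ∀ l u → dot l u ≡ 1# → h u ≢ 0# → ∀ t → p ℕ.* weight (restrict (dot l) t h) ≡ weight h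
  flat-slices {h = h} hom flat h𝟎≢0 l u lu≡1 hu≢0 t = trans
    (cong (p ℕ.*_) (C.ΣV-cong (nz-restrict (dot l) t h)))
    (equidistribution l u (λ x → nz (h x)) lu≡1 invariant t)
    where
    open Flat flat
    multiple : ∀ s → h (s ⊙ u) ≢ 0#
    multiple s with s ≟ 0#
    ... | yes refl = h𝟎≢0 ∘ trans (cong h (sym (0⊙ u)))
    ... | no  s≢0  = hu≢0 ∘ trans (sym (hom s u s≢0))
    invariant : ∀ s x → nz (h (x ⊕ s ⊙ u)) ≡ nz (h x)
    invariant s x = nz-⇔
      (λ hxu≢0 hx≡0 → ⊕-closed (x ⊕ s ⊙ u) ((- s) ⊙ u) hxu≢0 (multiple (- s))
        (trans (cong h (⊕-⊙-cancel x s u)) hx≡0))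
      (λ hx≢0 → ⊕-closed x (s ⊙ u) hx≢0 (multiple s))

  module Cone {m} {f : V m → F} (hom : Homogeneous f)
              (l v : V m) (lv≡1 : dot l v ≡ 1#) (flat : Flat (restrict (dot l) 0# f)) where
    open Flat flat

    f₀ : V m → F
    f₀ = restrict (dot l) 0# f

    π : V m → V m
    π x = x ⊕ (- dot l x) ⊙ v

    -- Because f is flat on l = 0, this is f(0) times the indicator of the subspace spanned by v and
    -- the support of `f₀`.
    cone : V m → F
    cone x = f (π x)

    dot-π : ∀ x → dot l (π x) ≡ 0#
    dot-π x = begin
      dot l (π x)                          ≡⟨ dot-⊕-⊙ l x _ v ⟩
      dot l x + (- dot l x) * dot l v      ≡⟨ cong (λ a → dot l x + (- dot l x) * a) lv≡1 ⟩
      dot l x + (- dot l x) * 1#           ≡⟨ cong (dot l x +_) (*-identityʳ _) ⟩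
      dot l x + - dot l x                  ≡⟨ -‿inverseʳ _ ⟩
      0#                                   ∎
      where open ≡-Reasoning

    π-fixes : ∀ x → dot l x ≡ 0# → π x ≡ x
    π-fixes x lx≡0 = trans (cong (λ a → x ⊕ (- a) ⊙ v) lx≡0)
      (trans (cong (λ a → x ⊕ a ⊙ v) -0#≈0#) (⊕-0⊙ x v))

    π-⊙ : ∀ s x → π (s ⊙ x) ≡ s ⊙ π x
    π-⊙ s x = trans (cong (λ a → s ⊙ x ⊕ (- a) ⊙ v) (dot-⊙ l s x)) (sym (⊙-⊖ s x (dot l x) v))

    π-⊕ : ∀ x y → π (x ⊕ y) ≡ π x ⊕ π y
    π-⊕ x y = begin
      x ⊕ y ⊕ (- dot l (x ⊕ y)) ⊙ v
        ≡⟨ cong (λ a → x ⊕ y ⊕ (- a) ⊙ v) (dot-⊕ l x y) ⟩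
      x ⊕ y ⊕ (- (dot l x + dot l y)) ⊙ v
        ≡⟨ cong (λ a → x ⊕ y ⊕ a ⊙ v) (-‿+-comm (dot l x) (dot l y)) ⟨
      x ⊕ y ⊕ (- dot l x + - dot l y) ⊙ v
        ≡⟨ cong (x ⊕ y ⊕_) (⊙-+ _ _ v) ⟩
      (x ⊕ y) ⊕ ((- dot l x) ⊙ v ⊕ (- dot l y) ⊙ v)
        ≡⟨ ⊕-interchange x y _ _ ⟩
      π x ⊕ π y ∎
      where open ≡-Reasoning

    π-translate : ∀ x → dot l x ≡ 0# → π (x ⊕ v) ≡ x
    π-translate x lx≡0 = begin
      x ⊕ v ⊕ (- dot l (x ⊕ v)) ⊙ v
        ≡⟨ cong (λ a → x ⊕ v ⊕ (- a) ⊙ v)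
             (trans (dot-⊕ l x v) (trans (cong₂ _+_ lx≡0 lv≡1) (+-identityˡ 1#))) ⟩
      x ⊕ v ⊕ (- 1#) ⊙ v
        ≡⟨ cong (λ y → x ⊕ y ⊕ (- 1#) ⊙ v) (1⊙ v) ⟨
      x ⊕ 1# ⊙ v ⊕ (- 1#) ⊙ v
        ≡⟨ ⊕-⊙-cancel x 1# v ⟩
      x ∎
      where open ≡-Reasoning

    f₀-π : ∀ x → f₀ (π x) ≡ cone x
    f₀-π x = restrict-on (dot l) 0# f (dot-π x)

    cone-homogeneous : Homogeneous cone
    cone-homogeneous s x s≢0 = trans (cong f (π-⊙ s x)) (hom s (π x) s≢0)

    -- Exactly one multiple of v brings x back to l = 0, so the cone is the spread of `f₀` along v
    -- and regains the q orders that restricting f to l = 0 costs.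
    cone-orth : ∀ {N} → Orth N f₀ → Orth (q ℕ.+ N) cone
    cone-orth {N} o = orth-cong (q ℕ.+ N)
      (λ x → trans (S.sum-single (λ s → f₀ (x ⊕ (- s) ⊙ v)) (dot l x) (off x)) (f₀-π x))
      (orth-spread N v f₀ o)
      where
      off : ∀ x s → s ≢ dot l x → f₀ (x ⊕ (- s) ⊙ v) ≡ 0#
      off x s s≢ = restrict-off (dot l) 0# f λ eq → s≢ (sym (difference-zero
        (trans (cong (dot l x +_) (sym (trans (cong ((- s) *_) lv≡1) (*-identityʳ (- s)))))
          (trans (sym (dot-⊕-⊙ l x (- s) v)) eq))))

    -- On the chart l = 1 the cone is the translate of `f₀` by v, and k v = 0 keeps every slice of k
    -- in place.
    weight-cone-slice : ∀ k t → dot k v ≡ 0# →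
      weight (restrict (dot k) t (restrict (dot l) 1# cone)) ≡ weight (restrict (dot k) t f₀)
    weight-cone-slice k t kv≡0 = trans
      (sym (ΣV-translate (λ x → nz (restrict (dot k) t (restrict (dot l) 1# cone) x)) v))
      (weight-cong pointwise)
      where
      translate-k : ∀ x → dot k (x ⊕ v) ≡ dot k x
      translate-k x = trans (dot-⊕ k x v) (trans (cong (dot k x +_) kv≡0) (+-identityʳ _))
      translate-l : ∀ x → dot l (x ⊕ v) ≡ dot l x + 1#
      translate-l x = trans (dot-⊕ l x v) (cong (dot l x +_) lv≡1)
      slice : ∀ x → restrict (dot l) 1# cone (x ⊕ v) ≡ f₀ x
      slice x with dot l x ≟ 0#
      ... | yes lx≡0 = trans
        (restrict-on (dot l) 1# cone (trans (translate-l x) (trans (cong (_+ 1#) lx≡0) (+-identityˡ 1#))))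
        (cong f (π-translate x lx≡0))
      ... | no lx≢0 = restrict-off (dot l) 1# cone λ eq → lx≢0 (begin
        dot l x               ≡⟨ +-inverse-cancel (dot l x) 1# ⟨
        dot l x + 1# + - 1#   ≡⟨ cong (_+ - 1#) (trans (sym (translate-l x)) eq) ⟩
        1# + - 1#             ≡⟨ -‿inverseʳ 1# ⟩
        0#                    ∎)
        where open ≡-Reasoning
      pointwise : ∀ x → restrict (dot k) t (restrict (dot l) 1# cone) (x ⊕ v) ≡ restrict (dot k) t f₀ x
      pointwise x with dot k x ≟ t
      ... | yes kx≡t = trans (restrict-on (dot k) t (restrict (dot l) 1# cone) (trans (translate-k x) kx≡t)) (slice x)
      ... | no  kx≢t = restrict-off (dot k) t (restrict (dot l) 1# cone) (kx≢t ∘ trans (sym (translate-k x)))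

    -- The zero form has a single nonempty slice, so the slicewise statement covers the total.
    weight-cone : weight (restrict (dot l) 1# cone) ≡ weight f₀
    weight-cone = begin
      weight (restrict (dot l) 1# cone)
        ≡⟨ weight-fibres (dot 𝟎) (restrict (dot l) 1# cone) ⟨
      C.sum (λ t → weight (restrict (dot 𝟎) t (restrict (dot l) 1# cone)))
        ≡⟨ C.sum-cong (λ t → weight-cone-slice 𝟎 t (dot-𝟎ˡ v)) ⟩
      C.sum (λ t → weight (restrict (dot 𝟎) t f₀))
        ≡⟨ weight-fibres (dot 𝟎) f₀ ⟩
      weight f₀ ∎
      where open ≡-Reasoning

    difference : V m → F
    difference x = f x + - cone x

    difference-homogeneous : Homogeneous difference
    difference-homogeneous s x s≢0 =
      cong₂ (λ a b → a + - b) (hom s x s≢0) (cone-homogeneous s x s≢0)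

    difference-vanishes : ∀ x → dot l x ≡ 0# → difference x ≡ 0#
    difference-vanishes x lx≡0 =
      trans (cong (λ y → f x + - f y) (π-fixes x lx≡0)) (-‿inverseʳ (f x))

    -- Both f and the cone have q + N orders, and their difference vanishes on l = 0, so the chart
    -- keeps one order more than N.
    difference-orth : ∀ {N} → Orth (q ℕ.+ N) f → Orth (suc N) (restrict (dot l) 1# difference)
    difference-orth {N} o = orth-chart l difference difference-vanishes
      (orth-+ (q ℕ.+ N) o (orth-cong (q ℕ.+ N) (λ x → negate (cone x))
        (orth-*ˡ (q ℕ.+ N) (- 1#) (cone-orth (orth-restrict 0# (dot-affine l) o)))))
      where
      negate : ∀ a → (- 1#) * a ≡ - a
      negate a = trans (sym (-‿distribˡ-* 1# a)) (cong -_ (*-identityˡ a))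

    module _ (d≡0 : weight (restrict (dot l) 1# difference) ≡ 0) where

      f≡cone : ∀ x → f x ≡ cone x
      f≡cone x = difference-zero
        (homogeneous-zero l difference-homogeneous difference-vanishes d≡0 x)

      weight-cone-total : weight f ≡ p ℕ.* weight f₀
      weight-cone-total = begin
        weight f
          ≡⟨ weight-homogeneous hom l ⟩
        weight f₀ ℕ.+ q ℕ.* weight (restrict (dot l) 1# f)
          ≡⟨ cong (λ w → weight f₀ ℕ.+ q ℕ.* w) (trans (weight-cong pointwise) weight-cone) ⟩
        suc q ℕ.* weight f₀
          ≡⟨ cong (ℕ._* weight f₀) p≡1+q ⟨
        p ℕ.* weight f₀ ∎
        where
        open ≡-Reasoning
        pointwise : ∀ x → restrict (dot l) 1# f x ≡ restrict (dot l) 1# cone x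
        pointwise x with dot l x ≟ 1#
        ... | yes _ = f≡cone x
        ... | no  _ = refl

      cone-flat : Flat f
      cone-flat = record
        { ⊕-closed = λ x y fx≢0 fy≢0 fxy≡0 →
            ⊕-closed (π x) (π y) (project x fx≢0) (project y fy≢0)
              (trans (cong f₀ (sym (π-⊕ x y))) (trans (f₀-π (x ⊕ y)) (trans (sym (f≡cone (x ⊕ y))) fxy≡0)))
        ; constant = λ x fx≢0 → trans (f≡cone x) (trans (sym (f₀-π x))
            (trans (constant (π x) (project x fx≢0)) (restrict-𝟎 l f)))
        }
        where
        project : ∀ x → f x ≢ 0# → f₀ (π x) ≢ 0#
        project x fx≢0 eq = fx≢0 (trans (f≡cone x) (trans (sym (f₀-π x)) eq))

-- The case f(0) ≠ 0: light functions are carried by subspaces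

module FlatTheorem {p q : ℕ} (K : PrimeField p q) where
  open PrimeField K
  open LinearAlgebra K
  open Orthogonality K
  open Weights K
  open MinimumWeight K
  open Hyperplanes K
  open Flats K
  open NatSum using (sum-filter; sum-min)

  -- When f 𝟎 ≢ 0#: fewer than 2 p^(k-1) projective points in the support.
  Light : ∀ {m} → ℕ → (V m → F) → Set
  Light k f = p ℕ.* weight f < 2 ℕ.* (q ℕ.* p ^ k) ℕ.+ p

  -- The strict bound in `Light` is itself p times 2q p^k + 1, so dividing by p costs nothing.
  light-bound : ∀ {m} k (f : V m → F) → Light (suc k) f → weight f ≤ 2 ℕ.* (q ℕ.* p ^ k)
  light-bound k f light = ℕₚ.≮⇒≥ λ heavy → ℕₚ.<⇒≱ light (begin
    2 ℕ.* (q ℕ.* (p ℕ.* p ^ k)) ℕ.+ p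
      ≡⟨ solve 3 (λ q p P → con 2 :* (q :* (p :* P)) :+ p := p :* (con 1 :+ con 2 :* (q :* P))) refl q p (p ^ k) ⟩
    p ℕ.* suc (2 ℕ.* (q ℕ.* p ^ k))
      ≤⟨ ℕₚ.*-monoʳ-≤ p heavy ⟩
    p ℕ.* weight f ∎)
    where
    open ℕₚ.≤-Reasoning
    open +-*-Solver

  p^k≥1 : ∀ k → 1 ≤ p ^ k
  p^k≥1 k = ℕ.>-nonZero⁻¹ (p ^ k) {{ℕₚ.m^n≢0 p k}}

  -- The conclusion says that f is f(0) times the indicator of a k-dimensional vector subspace. The
  -- weight travels with flatness because later steps compare it with slice counts.
  LightFlat : ℕ → Set
  LightFlat k = ∀ {m} (f : V m → F) → Homogeneous f → Orth (k ℕ.* q) f → f 𝟎 ≢ 0# →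
                Light k f → weight f ≡ p ^ k × Flat f

  -- In vector dimension one T is the origin alone, so no pencil cuts it properly. Instead the
  -- weight bound leaves a single vector v on l = 1; the difference from the cone lives at v only,
  -- while the slice bound asks for two nonzero values.
  module PointStep {m} {f : V m → F} (hom : Homogeneous f) (f𝟎≢0 : f 𝟎 ≢ 0#)
                   (o : Orth (q ℕ.+ 0) f) (light : Light 1 f) (l : V m)
                   (w₀≡1 : weight (restrict (dot l) 0# f) ≡ 1)
                   (flat : Flat (restrict (dot l) 0# f))
                   (v : V m) (f₁v≢0 : restrict (dot l) 1# f v ≢ 0#) where

    E≤1 : weight (restrict (dot l) 1# f) ≤ 1
    E≤1 = ℕₚ.≮⇒≥ λ 2≤E → ℕₚ.<⇒≱ (begin-strict
      q ℕ.* 2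
        ≤⟨ ℕₚ.*-monoʳ-≤ q 2≤E ⟩
      q ℕ.* weight (restrict (dot l) 1# f)
        <⟨ ℕₚ.n<1+n _ ⟩
      1 ℕ.+ q ℕ.* weight (restrict (dot l) 1# f)
        ≡⟨ cong (ℕ._+ q ℕ.* weight (restrict (dot l) 1# f)) w₀≡1 ⟨
      weight (restrict (dot l) 0# f) ℕ.+ q ℕ.* weight (restrict (dot l) 1# f)
        ≡⟨ weight-homogeneous hom l ⟨
      weight f
        ≤⟨ light-bound 0 f light ⟩
      2 ℕ.* (q ℕ.* 1)
        ≡⟨ cong (2 ℕ.*_) (ℕₚ.*-identityʳ q) ⟩
      2 ℕ.* q ∎) (ℕₚ.≤-reflexive (ℕₚ.*-comm 2 q))
      where open ℕₚ.≤-Reasoning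

    lv≡1 : dot l v ≡ 1#
    lv≡1 = proj₁ (restrict-support (dot l) 1# f f₁v≢0)

    open Cone hom l v lv≡1 flat public

    d₁ : V m → F
    d₁ = restrict (dot l) 1# difference

    support-at-v : ∀ x → x ≢ v → d₁ x ≡ 0#
    support-at-v x x≢v with dot l x ≟ 1#
    ... | no _     = refl
    ... | yes lx≡1 = trans (cong₂ (λ a b → a + - b) fx≡0 cone≡0) (-‿inverseʳ 0#)
      where
      fx≡0 : f x ≡ 0#
      fx≡0 with f x ≟ 0#
      ... | yes eq   = eq
      ... | no fx≢0 = contradiction (weight-unique (restrict (dot l) 1# f) E≤1
        (fx≢0 ∘ trans (sym (restrict-on (dot l) 1# f lx≡1))) f₁v≢0) x≢v
      x≡v : π x ≡ 𝟎 → x ≡ v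
      x≡v πx≡𝟎 = begin
        x                                    ≡⟨ ⊙-⊕-cancel x (dot l x) v ⟨
        π x ⊕ dot l x ⊙ v                    ≡⟨ cong₂ (λ y a → y ⊕ a ⊙ v) πx≡𝟎 lx≡1 ⟩
        𝟎 ⊕ 1# ⊙ v                           ≡⟨ trans (𝟎⊕ _) (1⊙ v) ⟩
        v                                    ∎
        where open ≡-Reasoning
      cone≡0 : cone x ≡ 0#
      cone≡0 with cone x ≟ 0#
      ... | yes eq  = eq
      ... | no cx≢0 = contradiction (x≡v (weight-unique f₀ (ℕₚ.≤-reflexive w₀≡1)
        (cx≢0 ∘ trans (sym (f₀-π x))) (f𝟎≢0 ∘ trans (sym (restrict-𝟎 l f))))) x≢v

    difference-zero-weight : weight d₁ ≡ 0
    difference-zero-weight with weight d₁ in eq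
    ... | zero  = refl
    ... | suc _ = contradiction (begin
      2               ≤⟨ minimum-weight d₁ 0 1 (difference-orth o) (proj₁ d-witness) (proj₂ d-witness) ⟩
      weight d₁       ≡⟨ C.ΣV-single (λ x → nz (d₁ x)) v (λ x x≢v → nz-zero (support-at-v x x≢v)) ⟩
      nz (d₁ v)       ≤⟨ nz≤1 (d₁ v) ⟩
      1               ∎) λ { (s≤s ()) }
      where
      open ℕₚ.≤-Reasoning
      d-witness = weight-witness d₁ (subst (1 ≤_) (sym eq) (s≤s z≤n))

  -- The difference of f and the cone vanishes on l = 0 and k = 0; its nonzero slices
  -- along the pencil then weigh too much.
  module ConeStep {m} {f : V m → F} (hom : Homogeneous f) (f𝟎≢0 : f 𝟎 ≢ 0#) (n : ℕ)
                  (o : Orth (q ℕ.+ (q ℕ.+ n ℕ.* q)) f) (light : Light (suc (suc n)) f)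
                  (l k v : V m) (lv≡1 : dot l v ≡ 1#) (kv≡0 : dot k v ≡ 0#)
                  (flat₀ : Flat (restrict (dot l) 0# f))
                  (w₀≡ : weight (restrict (dot l) 0# f) ≡ p ^ suc n)
                  (slices₀ : ∀ t → weight (restrict (dot k) t (restrict (dot l) 0# f)) ≡ p ^ n)
                  (fv≢0 : f v ≢ 0#)
                  (flat₁ : Flat (restrict (dot k) 0# f)) where
    open Cone hom l v lv≡1 flat₀ public

    P : ℕ
    P = p ^ n

    slice : F → (V m → F) → V m → F
    slice t g = restrict (dot k) t (restrict (dot l) 1# g)

    d₁ : V m → F
    d₁ = restrict (dot l) 1# difference

    slice-difference : ∀ t x → slice t difference x ≡ slice t f x + - slice t cone x
    slice-difference t x = trans
      (cong (λ a → if does (dot k x ≟ t) then a else 0#) (restrict-difference (dot l) 1# f cone x))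
      (restrict-difference (dot k) t (restrict (dot l) 1# f) (restrict (dot l) 1# cone) x)

    weight-slice-cone : ∀ t → weight (slice t cone) ≡ P
    weight-slice-cone t = trans (weight-cone-slice k t kv≡0) (slices₀ t)

    slice-triangle : ∀ t → weight (slice t difference) ≤ weight (slice t f) ℕ.+ P
    slice-triangle t = begin
      weight (slice t difference)
        ≡⟨ weight-cong (slice-difference t) ⟩
      weight (λ x → slice t f x + - slice t cone x)
        ≤⟨ weight-difference (slice t f) (slice t cone) ⟩
      weight (slice t f) ℕ.+ weight (slice t cone)
        ≡⟨ cong (weight (slice t f) ℕ.+_) (weight-slice-cone t) ⟩
      weight (slice t f) ℕ.+ P ∎
      where open ℕₚ.≤-Reasoning

    zero-slice : ∀ t → ¬ 1 ≤ weight (slice t difference) → P ≤ weight (slice t f)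
    zero-slice t w≱1 = ℕₚ.≤-reflexive (sym (trans
      (weight-cong (λ x → difference-zero (trans (sym (slice-difference t x))
        (weight-zero (slice t difference) (ℕₚ.n<1⇒n≡0 (ℕₚ.≰⇒> w≱1)) x))))
      (weight-slice-cone t)))

    -- On k = 0 the support of f is a subspace containing v, so x and its projection `π x` along v
    -- are both inside or both outside; inside, f equals f(0).
    difference-vanishes-k : ∀ x → dot k x ≡ 0# → difference x ≡ 0#
    difference-vanishes-k x kx≡0 = trans (cong (λ a → f x + - a) (sym fx≡cone)) (-‿inverseʳ (f x))
      where
      open Flat flat₁
      f₁ = restrict (dot k) 0# f
      on : ∀ {y} → dot k y ≡ 0# → f₁ y ≡ f y
      on = restrict-on (dot k) 0# f
      f₁-multiple : ∀ s → f₁ (s ⊙ v) ≢ 0#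
      f₁-multiple s eq with s ≟ 0#
      ... | yes refl = f𝟎≢0 (trans (sym (restrict-𝟎 k f)) (trans (cong f₁ (sym (0⊙ v))) eq))
      ... | no s≢0   = fv≢0 (trans (sym (hom s v s≢0)) (trans
        (sym (on (trans (dot-⊙ k s v) (trans (cong (s *_) kv≡0) (zeroʳ s))))) eq))
      kπx≡0 : dot k (π x) ≡ 0#
      kπx≡0 = trans (dot-⊕-⊙ k x _ v) (trans (cong₂ _+_ kx≡0
        (trans (cong ((- dot l x) *_) kv≡0) (zeroʳ _))) (+-identityˡ 0#))
      constant-f : ∀ {y} → dot k y ≡ 0# → f y ≢ 0# → f y ≡ f 𝟎
      constant-f {y} ky≡0 fy≢0 = trans (sym (on ky≡0))
        (trans (constant y (fy≢0 ∘ trans (sym (on ky≡0)))) (restrict-𝟎 k f))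
      fx≡cone : f x ≡ cone x
      fx≡cone with f x ≟ 0# | f (π x) ≟ 0#
      ... | yes fx≡0 | yes cx≡0 = trans fx≡0 (sym cx≡0)
      ... | no  fx≢0 | no  cx≢0 = trans (constant-f kx≡0 fx≢0) (sym (constant-f kπx≡0 cx≢0))
      ... | no  fx≢0 | yes cx≡0 = contradiction (trans (on kπx≡0) cx≡0)
        (⊕-closed x ((- dot l x) ⊙ v) (fx≢0 ∘ trans (sym (on kx≡0))) (f₁-multiple _))
      ... | yes fx≡0 | no  cx≢0 = contradiction
        (trans (cong f₁ (⊙-⊕-cancel x (dot l x) v)) (trans (on kx≡0) fx≡0))
        (⊕-closed (π x) (dot l x ⊙ v) (cx≢0 ∘ trans (sym (on kπx≡0))) (f₁-multiple _))

    zero-slice-0 : ¬ 1 ≤ weight (slice 0# difference)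
    zero-slice-0 1≤w with weight-witness (slice 0# difference) 1≤w
    ... | x , dx≢0 with restrict-support (dot k) 0# (restrict (dot l) 1# difference) {x} dx≢0
    ...   | kx≡0 , d₁x≢0 = proj₂ (restrict-support (dot l) 1# difference {x} d₁x≢0)
                             (difference-vanishes-k x kx≡0)

    nonzero? = λ t → 1 ℕ.≤? weight (slice t difference)

    few-slices : length (support-list (dot k) d₁) ≤ q
    few-slices = ℕₚ.≤-pred (ℕₚ.≤-trans
      (filter-notAll nonzero? (allFin p) (Any.map (λ { refl → zero-slice-0 }) (∈-allFin 0#)))
      length-allFin)

    -- From q = δ + 1 + s follows (δ + 1)(s + 2) + (s + 1) = 2q + 1 + δ s, so the right side exceeds
    -- the left by P + q δ s P. The slack is a single P when δ or s is zero.
    arithmetic : ∀ δ s → δ ℕ.+ suc s ≡ q →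
      2 ℕ.* (q ℕ.* p ^ suc n) < p ^ suc n ℕ.+ q ℕ.* (suc δ ℕ.* (suc (suc s) ℕ.* P) ℕ.+ suc s ℕ.* P)
    arithmetic δ s δ+1+s≡q = begin-strict
      2 ℕ.* (q ℕ.* (p ℕ.* P))
        <⟨ ℕₚ.m<m+n _ (p^k≥1 n) ⟩
      2 ℕ.* (q ℕ.* (p ℕ.* P)) ℕ.+ P
        ≤⟨ ℕₚ.m≤m+n _ (q ℕ.* (δ ℕ.* s ℕ.* P)) ⟩
      2 ℕ.* (q ℕ.* (p ℕ.* P)) ℕ.+ P ℕ.+ q ℕ.* (δ ℕ.* s ℕ.* P)
        ≡⟨ cong₂ (λ p q → 2 ℕ.* (q ℕ.* (p ℕ.* P)) ℕ.+ P ℕ.+ q ℕ.* (δ ℕ.* s ℕ.* P)) p≡ (sym δ+1+s≡q) ⟩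
      2 ℕ.* (q′ ℕ.* (suc q′ ℕ.* P)) ℕ.+ P ℕ.+ q′ ℕ.* (δ ℕ.* s ℕ.* P)
        ≡⟨ solve 3 (λ δ s P → let q = δ :+ (con 1 :+ s) in
             con 2 :* (q :* ((con 1 :+ q) :* P)) :+ P :+ q :* (δ :* s :* P) :=
             (con 1 :+ q) :* P :+ q :* ((con 1 :+ δ) :* ((con 2 :+ s) :* P) :+ (con 1 :+ s) :* P))
             refl δ s P ⟩
      suc q′ ℕ.* P ℕ.+ q′ ℕ.* (suc δ ℕ.* (suc (suc s) ℕ.* P) ℕ.+ suc s ℕ.* P)
        ≡⟨ cong₂ (λ p q → p ℕ.* P ℕ.+ q ℕ.* (suc δ ℕ.* (suc (suc s) ℕ.* P) ℕ.+ suc s ℕ.* P))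
             (sym p≡) δ+1+s≡q ⟩
      p ℕ.* P ℕ.+ q ℕ.* (suc δ ℕ.* (suc (suc s) ℕ.* P) ℕ.+ suc s ℕ.* P) ∎
      where
      open ℕₚ.≤-Reasoning
      open +-*-Solver
      q′ = δ ℕ.+ suc s
      p≡ : p ≡ suc q′
      p≡ = trans p≡1+q (cong suc (sym δ+1+s≡q))

    difference-zero-weight : weight d₁ ≡ 0
    difference-zero-weight with weight d₁ in eq
    ... | zero  = refl
    ... | suc _ = contradiction (light-bound (suc n) f light) (ℕₚ.<⇒≱ heavy)
      where
      d-witness = weight-witness d₁ (subst (1 ≤_) (sym eq) (s≤s z≤n))
      heavy : 2 ℕ.* (q ℕ.* p ^ suc n) < weight f
      heavy with length (support-list (dot k) d₁) in |L|≡
      ... | zero  = contradiction (subst (1 ≤_) |L|≡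
        (∈-length (support-list-complete (dot k) d₁ (proj₁ d-witness) (proj₂ d-witness)))) λ ()
      -- There are δ + 1 slices with a nonzero difference, at most q of them since the slice k = 0
      -- has none; of all p slices, s + 1 agree with the cone.
      ... | suc δ with ℕₚ.m≤n⇒∃[o]m+o≡n (subst (_≤ q) |L|≡ few-slices)
      ...   | s , 1+δ+s≡q = begin-strict
        2 ℕ.* (q ℕ.* p ^ suc n)
          <⟨ arithmetic δ s δ+1+s≡q ⟩
        p ^ suc n ℕ.+ q ℕ.* (suc δ ℕ.* (suc (suc s) ℕ.* P) ℕ.+ suc s ℕ.* P)
          ≤⟨ ℕₚ.+-monoʳ-≤ (p ^ suc n) (ℕₚ.*-monoʳ-≤ q E≥) ⟩
        p ^ suc n ℕ.+ q ℕ.* weight (restrict (dot l) 1# f)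
          ≡⟨ cong (ℕ._+ q ℕ.* weight (restrict (dot l) 1# f)) w₀≡ ⟨
        weight f₀ ℕ.+ q ℕ.* weight (restrict (dot l) 1# f)
          ≡⟨ weight-homogeneous hom l ⟨
        weight f ∎
        where
        open ℕₚ.≤-Reasoning
        δ+1+s≡q : δ ℕ.+ suc s ≡ q
        δ+1+s≡q = trans (ℕₚ.+-suc δ s) 1+δ+s≡q
        -- Passing to one of δ + 1 nonempty slices costs δ orders; with q = δ + 1 + s this leaves s
        -- + 2 beyond n blocks of q.
        orders : suc (q ℕ.+ n ℕ.* q) ≡ δ ℕ.+ (n ℕ.* q ℕ.+ suc (suc s))
        orders = trans (cong (λ r → suc (r ℕ.+ n ℕ.* q)) (sym δ+1+s≡q))
          (N.solve 3 (λ δ s E → N.con 1 N.:+ (δ N.:+ (N.con 1 N.:+ s) N.:+ E) N.:=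
                               δ N.:+ (E N.:+ (N.con 2 N.:+ s))) refl δ s (n ℕ.* q))
          where module N = +-*-Solver
        -- The difference has at least s + 3 times P values on the slice, and the cone can account
        -- for only one P.
        nonzero-slice : ∀ t → 1 ≤ weight (slice t difference) → suc (suc s) ℕ.* P ≤ weight (slice t f)
        nonzero-slice t 1≤w = ℕₚ.+-cancelʳ-≤ P _ _ (begin
          suc (suc s) ℕ.* P ℕ.+ P
            ≡⟨ ℕₚ.+-comm _ P ⟩
          suc (suc (suc s)) ℕ.* P
            ≤⟨ minimum-weight (slice t difference) n (suc (suc s))
                 (orth-support-slice d₁ (dot k) t (dot-affine k) (ℕₚ.≤-reflexive |L|≡) 1≤w
                   (subst (λ N → Orth N d₁) orders (difference-orth o)))
                 (proj₁ witness) (proj₂ witness) ⟩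
          weight (slice t difference)
            ≤⟨ slice-triangle t ⟩
          weight (slice t f) ℕ.+ P ∎)
          where witness = weight-witness (slice t difference) 1≤w
        E≥ : suc δ ℕ.* (suc (suc s) ℕ.* P) ℕ.+ suc s ℕ.* P ≤ weight (restrict (dot l) 1# f)
        E≥ = from-filter (sum-filter nonzero? (λ t → weight (slice t f)) P (suc (suc s) ℕ.* P)
                            nonzero-slice zero-slice {p} (λ t → t))
          where
          L = support-list (dot k) d₁
          from-filter : (∃ λ s′ → length L ℕ.+ s′ ≡ p ×
            length L ℕ.* (suc (suc s) ℕ.* P) ℕ.+ s′ ℕ.* P ≤ C.sum (λ t → weight (slice t f))) →
            suc δ ℕ.* (suc (suc s) ℕ.* P) ℕ.+ suc s ℕ.* P ≤ weight (restrict (dot l) 1# f)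
          from-filter (s′ , |L|+s′≡p , bound) = begin
            suc δ ℕ.* (suc (suc s) ℕ.* P) ℕ.+ suc s ℕ.* P
              ≡⟨ cong₂ (λ u z → u ℕ.* (suc (suc s) ℕ.* P) ℕ.+ z ℕ.* P) (sym |L|≡) (sym s′≡) ⟩
            length (support-list (dot k) d₁) ℕ.* (suc (suc s) ℕ.* P) ℕ.+ s′ ℕ.* P
              ≤⟨ bound ⟩
            C.sum (λ t → weight (slice t f))
              ≡⟨ weight-fibres (dot k) (restrict (dot l) 1# f) ⟩
            weight (restrict (dot l) 1# f) ∎
            where
            s′≡ : s′ ≡ suc s
            s′≡ = ℕₚ.+-cancelˡ-≡ (suc δ) s′ (suc s)
              (trans (cong (ℕ._+ s′) (sym |L|≡)) (trans |L|+s′≡p (trans p≡1+q (cong suc (sym δ+1+s≡q)))))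

  pencil-at : ∀ {m} (l k : V m) t x → dot l x ≡ 1# → dot (k ⊕ (- t) ⊙ l) x ≡ dot k x + - t
  pencil-at l k t x lx≡1 = trans (dot-pencil k l (- t) x)
    (cong (dot k x +_) (trans (cong ((- t) *_) lx≡1) (*-identityʳ (- t))))

  -- On l = 1 the hyperplanes through the axis l = k = 0 become the parallel slices of k; the member
  -- l = 0 itself lies at infinity.
  pencil-chart : ∀ {m} (l k : V m) t f x →
    restrict (dot l) 1# (restrict (dot (k ⊕ (- t) ⊙ l)) 0# f) x ≡ restrict (dot k) t (restrict (dot l) 1# f) x
  pencil-chart l k t f x with dot l x ≟ 1# | dot k x ≟ t
  ... | no  _    | yes _    = refl
  ... | no  _    | no  _    = refl
  ... | yes lx≡1 | yes kx≡t = restrict-on (dot (k ⊕ (- t) ⊙ l)) 0# f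
    (trans (pencil-at l k t x lx≡1) (trans (cong (_+ - t) kx≡t) (-‿inverseʳ t)))
  ... | yes lx≡1 | no  kx≢t = restrict-off (dot (k ⊕ (- t) ⊙ l)) 0# f
    (λ eq → kx≢t (difference-zero (trans (sym (pencil-at l k t x lx≡1)) eq)))

  -- Of the p hyperplanes through the axis other than l = 0, τ selects the one with fewest support
  -- vectors on the chart. The vector u of T lies off it, so it cuts T in exactly P vectors.
  module PencilStep {m} {f : V m → F} (hom : Homogeneous f) (f𝟎≢0 : f 𝟎 ≢ 0#) (n : ℕ)
                    (o : Orth (suc (suc n) ℕ.* q) f) (light : Light (suc (suc n)) f)
                    (l : V m) (flat₀ : Flat (restrict (dot l) 0# f))
                    (w₀≡ : weight (restrict (dot l) 0# f) ≡ p ^ suc n)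
                    (ih : LightFlat (suc n))
                    (k₀ u : V m) (k₀u≡1 : dot k₀ u ≡ 1#) (f₀u≢0 : restrict (dot l) 0# f u ≢ 0#)
                    (τ : F)
                    (τ-min : p ℕ.* weight (restrict (dot k₀) τ (restrict (dot l) 1# f)) ≤
                             C.sum (λ t → weight (restrict (dot k₀) t (restrict (dot l) 1# f)))) where

    P : ℕ
    P = p ^ n

    f₀ f₁ : V m → F
    f₀ = restrict (dot l) 0# f
    f₁ = restrict (dot l) 1# f

    f₀𝟎≢0 : f₀ 𝟎 ≢ 0#
    f₀𝟎≢0 = f𝟎≢0 ∘ trans (sym (restrict-𝟎 l f))

    lu≡0 : dot l u ≡ 0#
    lu≡0 = proj₁ (restrict-support (dot l) 0# f f₀u≢0)

    k : V m
    k = k₀ ⊕ (- τ) ⊙ l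

    ku≡1 : dot k u ≡ 1#
    ku≡1 = trans (dot-pencil k₀ l (- τ) u) (trans
      (cong₂ _+_ k₀u≡1 (trans (cong ((- τ) *_) lu≡0) (zeroʳ _))) (+-identityʳ 1#))

    slices₀ : ∀ t → weight (restrict (dot k) t f₀) ≡ P
    slices₀ t = ℕₚ.*-cancelˡ-≡ _ _ p (trans
      (flat-slices (restrict-homogeneous l hom) flat₀ f₀𝟎≢0 k u ku≡1 f₀u≢0 t) w₀≡)

    g : V m → F
    g = restrict (dot k) 0# f

    E : ℕ
    E = weight (restrict (dot k₀) τ f₁)

    chart-k : ∀ x → restrict (dot l) 1# g x ≡ restrict (dot k₀) τ f₁ x
    chart-k = pencil-chart l k₀ τ f

    weight-g : weight g ≡ P ℕ.+ q ℕ.* E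
    weight-g = trans (weight-homogeneous (restrict-homogeneous k hom) l) (cong₂ (λ a b → a ℕ.+ q ℕ.* b)
      (trans (weight-cong (restrict-comm (dot l) (dot k) 0# 0# f)) (slices₀ 0#))
      (weight-cong chart-k))

    -- Multiplying by p counts the axis p times, and p P is the weight of `f₀`; with the minimality
    -- of τ, p times the weight of g is therefore at most the weight of f.
    g-light : Light (suc n) g
    g-light = begin-strict
      p ℕ.* weight g
        ≡⟨ cong (p ℕ.*_) weight-g ⟩
      p ℕ.* (P ℕ.+ q ℕ.* E)
        ≡⟨ solve 4 (λ p P q E → p :* (P :+ q :* E) := p :* P :+ q :* (p :* E)) refl p P q E ⟩
      p ℕ.* P ℕ.+ q ℕ.* (p ℕ.* E)
        ≤⟨ ℕₚ.+-monoʳ-≤ (p ℕ.* P) (ℕₚ.*-monoʳ-≤ q τ-min) ⟩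
      p ℕ.* P ℕ.+ q ℕ.* C.sum (λ t → weight (restrict (dot k₀) t f₁))
        ≡⟨ cong₂ (λ a b → a ℕ.+ q ℕ.* b) (sym w₀≡) (weight-fibres (dot k₀) f₁) ⟩
      weight f₀ ℕ.+ q ℕ.* weight f₁
        ≡⟨ weight-homogeneous hom l ⟨
      weight f
        ≤⟨ light-bound (suc n) f light ⟩
      2 ℕ.* (q ℕ.* p ^ suc n)
        <⟨ ℕₚ.m<m+n _ p≥1 ⟩
      2 ℕ.* (q ℕ.* p ^ suc n) ℕ.+ p ∎
      where
      open ℕₚ.≤-Reasoning
      open +-*-Solver

    g-flat = ih g (restrict-homogeneous k hom) (orth-restrict 0# (dot-affine k) o)
      (f𝟎≢0 ∘ trans (sym (restrict-𝟎 k f))) g-light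

    -- Both P + q E and P + q P are the weight p^(n+1) of g. As P is positive, this supplies the
    -- vector v of the second hyperplane that lies off the first.
    E≡P : E ≡ P
    E≡P = ℕₚ.*-cancelˡ-≡ E P q {{ℕ.>-nonZero 1≤q}} (ℕₚ.+-cancelˡ-≡ P _ _
      (trans (sym weight-g) (trans (proj₁ g-flat) (cong (ℕ._* P) p≡1+q))))

    from-point : ∀ v → restrict (dot l) 1# g v ≢ 0# → weight f ≡ p ^ suc (suc n) × Flat f
    from-point v gv≢0 with restrict-support (dot l) 1# g {v} gv≢0
    ... | lv≡1 , gv≢0 with restrict-support (dot k) 0# f {v} gv≢0
    ...   | kv≡0 , fv≢0 = trans (weight-cone-total difference-zero-weight) (cong (p ℕ.*_) w₀≡) ,
                          cone-flat difference-zero-weight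
      where open ConeStep hom f𝟎≢0 n o light l k v lv≡1 kv≡0 flat₀ w₀≡ slices₀ fv≢0 (proj₂ g-flat)

    conclusion : weight f ≡ p ^ suc (suc n) × Flat f
    conclusion = from-point (proj₁ witness) (proj₂ witness)
      where
      witness = weight-witness (restrict (dot l) 1# g)
        (subst (1 ≤_) (sym (trans (weight-cong chart-k) E≡P)) (p^k≥1 n))

  light-flat-zero : LightFlat 0
  light-flat-zero f hom o f𝟎≢0 light = w≡1 , record
    { ⊕-closed = λ x y fx≢0 fy≢0 → f𝟎≢0 ∘ trans (cong f (sym (trans (cong₂ _⊕_ (origin fx≢0) (origin fy≢0)) (𝟎⊕ 𝟎))))
    ; constant = λ x fx≢0 → cong f (origin fx≢0)
    }
    where
    open ℕₚ.≤-Reasoning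
    w≤1 : weight f ≤ 1
    -- A second support vector brings all its multiples, so the weight is at least 1 + q = p, and p
    -- p = p q + p is at least 2q + p.
    w≤1 = ℕₚ.≮⇒≥ λ 2≤w → case-hyperplane 2≤w
      (light-hyperplane hom (subst (_< weight f) (sym (nz-nonzero f𝟎≢0)) 2≤w))
      where
      case-hyperplane : 2 ≤ weight f → (∃ λ l → p ℕ.* weight (restrict (dot l) 0# f) ≤ weight f ℕ.+ q ℕ.* nz (f 𝟎) ×
            1 ≤ weight (restrict (dot l) 1# f)) → ⊥
      case-hyperplane 2≤w (l , _ , 1≤E) = ℕₚ.<⇒≱ light (begin
        2 ℕ.* (q ℕ.* 1) ℕ.+ p
          ≡⟨ cong (λ r → 2 ℕ.* r ℕ.+ p) (ℕₚ.*-identityʳ q) ⟩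
        2 ℕ.* q ℕ.+ p
          ≤⟨ ℕₚ.+-monoˡ-≤ p (ℕₚ.*-monoˡ-≤ q 2≤p) ⟩
        p ℕ.* q ℕ.+ p
          ≡⟨ trans (ℕₚ.+-comm _ p) (sym (ℕₚ.*-suc p q)) ⟩
        p ℕ.* suc q
          ≤⟨ ℕₚ.*-monoʳ-≤ p (ℕₚ.≤-trans (ℕₚ.+-monoˡ-≤ q
               (weight-positive (restrict (dot l) 0# f) 𝟎 (f𝟎≢0 ∘ trans (sym (restrict-𝟎 l f)))))
               (chart-positive hom l 1≤E)) ⟩
        p ℕ.* weight f ∎)
    w≡1 : weight f ≡ 1
    w≡1 = ℕₚ.≤-antisym w≤1 (weight-positive f 𝟎 f𝟎≢0)
    origin : ∀ {x} → f x ≢ 0# → x ≡ 𝟎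
    origin fx≢0 = weight-unique f w≤1 fx≢0 f𝟎≢0
  light-flat-suc : ∀ k → LightFlat k → LightFlat (suc k)
  light-flat-suc k ih {m} f hom o f𝟎≢0 light = from-hyperplane (light-hyperplane hom nz<w)
    where
    module N = +-*-Solver
    nz<w : nz (f 𝟎) < weight f
    nz<w = begin-strict
      nz (f 𝟎)           ≡⟨ nz-nonzero f𝟎≢0 ⟩
      1                  <⟨ 2≤p ⟩
      p                  ≤⟨ ℕₚ.m≤m*n p (p ^ k) {{ℕₚ.m^n≢0 p k}} ⟩
      p ℕ.* p ^ k        ≡⟨ ℕₚ.+-identityʳ _ ⟨
      1 ℕ.* p ^ suc k    ≤⟨ minimum-weight f (suc k) 0
                              (subst (λ N → Orth N f) (sym (ℕₚ.+-identityʳ _)) o) 𝟎 f𝟎≢0 ⟩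
      weight f           ∎
      where open ℕₚ.≤-Reasoning
    -- The summand p in `Light` is what makes the bound inheritable: the origin's surplus q in the
    -- average turns p into p (1 + q), which after division by p is p again.
    f₀-light : ∀ l → p ℕ.* weight (restrict (dot l) 0# f) ≤ weight f ℕ.+ q ℕ.* nz (f 𝟎) →
               Light k (restrict (dot l) 0# f)
    f₀-light l hyperplane-light = ℕₚ.*-cancelˡ-< p _ _ (begin-strict
      p ℕ.* (p ℕ.* weight (restrict (dot l) 0# f))
        ≤⟨ ℕₚ.*-monoʳ-≤ p hyperplane-light ⟩
      p ℕ.* (weight f ℕ.+ q ℕ.* nz (f 𝟎))
        ≡⟨ cong (λ a → p ℕ.* (weight f ℕ.+ q ℕ.* a)) (nz-nonzero f𝟎≢0) ⟩
      p ℕ.* (weight f ℕ.+ q ℕ.* 1)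
        ≡⟨ N.solve 3 (λ p w q → p N.:* (w N.:+ q N.:* N.con 1) N.:= p N.:* w N.:+ p N.:* q) refl p (weight f) q ⟩
      p ℕ.* weight f ℕ.+ p ℕ.* q
        <⟨ ℕₚ.+-monoˡ-< (p ℕ.* q) light ⟩
      2 ℕ.* (q ℕ.* (p ℕ.* p ^ k)) ℕ.+ p ℕ.+ p ℕ.* q
        ≡⟨ N.solve 3 (λ q p P → N.con 2 N.:* (q N.:* (p N.:* P)) N.:+ p N.:+ p N.:* q N.:=
             p N.:* (N.con 2 N.:* (q N.:* P) N.:+ (N.con 1 N.:+ q))) refl q p (p ^ k) ⟩
      p ℕ.* (2 ℕ.* (q ℕ.* p ^ k) ℕ.+ suc q)
        ≡⟨ cong (λ r → p ℕ.* (2 ℕ.* (q ℕ.* p ^ k) ℕ.+ r)) p≡1+q ⟨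
      p ℕ.* (2 ℕ.* (q ℕ.* p ^ k) ℕ.+ p) ∎)
      where open ℕₚ.≤-Reasoning
    module _ (l : V m) (1≤E : 1 ≤ weight (restrict (dot l) 1# f))
             (flat₀ : Flat (restrict (dot l) 0# f)) where
      f₀ f₁ : V m → F
      f₀ = restrict (dot l) 0# f
      f₁ = restrict (dot l) 1# f
      f₀𝟎≢0 : f₀ 𝟎 ≢ 0#
      f₀𝟎≢0 = f𝟎≢0 ∘ trans (sym (restrict-𝟎 l f))
      from-witness : Orth (1 ℕ.* q) f → Light 1 f → weight f₀ ≡ 1 →
                     (∃ λ v → f₁ v ≢ 0#) → weight f ≡ p ^ 1 × Flat f
      from-witness o light w₀≡1 (v , f₁v≢0) =
        trans (weight-cone-total difference-zero-weight) (cong (p ℕ.*_) w₀≡1) ,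
        cone-flat difference-zero-weight
        where open PointStep hom f𝟎≢0 o light l w₀≡1 flat₀ v f₁v≢0
      from-pencil : ∀ n → LightFlat (suc n) → Orth (suc (suc n) ℕ.* q) f → Light (suc (suc n)) f →
        weight f₀ ≡ p ^ suc n → ∀ k₀ → (∃ λ u → restrict (dot k₀) 1# f₀ u ≢ 0#) →
        (∃ λ τ → p ℕ.* weight (restrict (dot k₀) τ f₁) ≤ C.sum (λ t → weight (restrict (dot k₀) t f₁))) →
        weight f ≡ p ^ suc (suc n) × Flat f
      from-pencil n ih o light w₀≡ k₀ (u , u-support) (τ , τ-min) =
        PencilStep.conclusion hom f𝟎≢0 n o light l flat₀ w₀≡ ih k₀ u
          (proj₁ (restrict-support (dot k₀) 1# f₀ u-support))
          (proj₂ (restrict-support (dot k₀) 1# f₀ u-support)) τ τ-min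
      by-dimension : ∀ k → LightFlat k → Orth (suc k ℕ.* q) f → Light (suc k) f → weight f₀ ≡ p ^ k →
                     weight f ≡ p ^ suc k × Flat f
      by-dimension zero    _  o light w₀≡ = from-witness o light w₀≡ (weight-witness f₁ 1≤E)
      -- T has more than one vector, so averaging on l = 0 yields a form `k₀` taking the value 1 on
      -- T; subtracting multiples of l from it produces the pencil.
      by-dimension (suc n) ih o light w₀≡ = second-hyperplane
        (light-hyperplane (restrict-homogeneous l hom)
          (subst (nz (f₀ 𝟎) <_) (sym w₀≡) (ℕₚ.≤-trans
            (ℕₚ.≤-reflexive (cong suc (nz-nonzero f₀𝟎≢0)))
            (ℕₚ.≤-trans 2≤p (ℕₚ.m≤m*n p (p ^ n) {{ℕₚ.m^n≢0 p n}})))))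
        where
        second-hyperplane : (∃ λ k₀ → p ℕ.* weight (restrict (dot k₀) 0# f₀) ≤ weight f₀ ℕ.+ q ℕ.* nz (f₀ 𝟎) ×
          1 ≤ weight (restrict (dot k₀) 1# f₀)) → weight f ≡ p ^ suc (suc n) × Flat f
        second-hyperplane (k₀ , _ , 1≤E₀) = from-pencil n ih o light w₀≡ k₀
          (weight-witness (restrict (dot k₀) 1# f₀) 1≤E₀)
          (sum-min (λ t → weight (restrict (dot k₀) t f₁)) 0#)
    from-hyperplane : (∃ λ l → p ℕ.* weight (restrict (dot l) 0# f) ≤ weight f ℕ.+ q ℕ.* nz (f 𝟎) ×
      1 ≤ weight (restrict (dot l) 1# f)) → weight f ≡ p ^ suc k × Flat f
    from-hyperplane (l , hyperplane-light , 1≤E) = by-dimension l 1≤E (proj₂ small) k ih o light (proj₁ small)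
      where
      small = ih (restrict (dot l) 0# f) (restrict-homogeneous l hom)
        (orth-restrict 0# (dot-affine l) o) (f𝟎≢0 ∘ trans (sym (restrict-𝟎 l f)))
        (f₀-light l hyperplane-light)

  light-flat : ∀ k → LightFlat k
  light-flat zero    = light-flat-zero
  light-flat (suc k) = light-flat-suc k (light-flat k)

-- The integers modulo p as a field, with falling factorials

module IntegersMod (p : ℕ) (pr : Prime p) where
  open PG p pr using (F; 0F; 1F; _+F_; _*F_; p≢0)

  infix 25 -F_

  ι : ℕ → F
  ι m = m mod p

  toℕ-ι : ∀ m → toℕ (ι m) ≡ m % p
  toℕ-ι m = toℕ-fromℕ< (m%n<n m p)

  ι-cong : ∀ {m n} → m % p ≡ n % p → ι m ≡ ι n
  ι-cong {m} {n} eq = toℕ-injective (trans (toℕ-ι m) (trans eq (sym (toℕ-ι n))))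

  ι-toℕ : ∀ a → ι (toℕ a) ≡ a
  ι-toℕ a = toℕ-injective (trans (toℕ-ι (toℕ a)) (m<n⇒m%n≡m (toℕ<n a)))

  ι-+ : ∀ m n → ι m +F ι n ≡ ι (m ℕ.+ n)
  ι-+ m n = ι-cong {toℕ (ι m) ℕ.+ toℕ (ι n)} (trans
    (%-congˡ {o = p} (cong₂ ℕ._+_ (toℕ-ι m) (toℕ-ι n))) (sym (%-distribˡ-+ m n p)))

  ι-* : ∀ m n → ι m *F ι n ≡ ι (m ℕ.* n)
  ι-* m n = ι-cong {toℕ (ι m) ℕ.* toℕ (ι n)} (trans
    (%-congˡ {o = p} (cong₂ ℕ._*_ (toℕ-ι m) (toℕ-ι n))) (sym (%-distribˡ-* m n p)))

  ι-p : ι p ≡ 0F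
  ι-p = ι-cong (trans (n%n≡0 p) (sym (m<n⇒m%n≡m (ℕ.>-nonZero⁻¹ p))))

  -- Every element is a residue of a natural number, so the ring laws are inherited from the
  -- naturals.
  lift₁ : ∀ {P : F → Set} → (∀ m → P (ι m)) → ∀ a → P a
  lift₁ {P} h a = subst P (ι-toℕ a) (h (toℕ a))

  +F-assoc : ∀ a b c → (a +F b) +F c ≡ a +F (b +F c)
  +F-assoc = lift₁ λ k → lift₁ λ m → lift₁ λ n → begin
    (ι k +F ι m) +F ι n   ≡⟨ trans (cong (_+F ι n) (ι-+ k m)) (ι-+ (k ℕ.+ m) n) ⟩
    ι (k ℕ.+ m ℕ.+ n)     ≡⟨ cong ι (ℕₚ.+-assoc k m n) ⟩
    ι (k ℕ.+ (m ℕ.+ n))   ≡⟨ trans (cong (ι k +F_) (ι-+ m n)) (ι-+ k (m ℕ.+ n)) ⟨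
    ι k +F (ι m +F ι n)   ∎
    where open ≡-Reasoning

  *F-assoc : ∀ a b c → (a *F b) *F c ≡ a *F (b *F c)
  *F-assoc = lift₁ λ k → lift₁ λ m → lift₁ λ n → begin
    (ι k *F ι m) *F ι n   ≡⟨ trans (cong (_*F ι n) (ι-* k m)) (ι-* (k ℕ.* m) n) ⟩
    ι (k ℕ.* m ℕ.* n)     ≡⟨ cong ι (ℕₚ.*-assoc k m n) ⟩
    ι (k ℕ.* (m ℕ.* n))   ≡⟨ trans (cong (ι k *F_) (ι-* m n)) (ι-* k (m ℕ.* n)) ⟨
    ι k *F (ι m *F ι n)   ∎
    where open ≡-Reasoning

  +F-comm : ∀ a b → a +F b ≡ b +F a
  +F-comm a b = cong ι (ℕₚ.+-comm (toℕ a) (toℕ b))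

  *F-comm : ∀ a b → a *F b ≡ b *F a
  *F-comm a b = cong ι (ℕₚ.*-comm (toℕ a) (toℕ b))

  0F+ : ∀ a → 0F +F a ≡ a
  0F+ = lift₁ (ι-+ 0)

  1F* : ∀ a → 1F *F a ≡ a
  1F* = lift₁ λ m → trans (ι-* 1 m) (cong ι (ℕₚ.*-identityˡ m))

  *F-distribˡ : ∀ a b c → a *F (b +F c) ≡ (a *F b) +F (a *F c)
  *F-distribˡ = lift₁ λ k → lift₁ λ m → lift₁ λ n → begin
    ι k *F (ι m +F ι n)              ≡⟨ trans (cong (ι k *F_) (ι-+ m n)) (ι-* k (m ℕ.+ n)) ⟩
    ι (k ℕ.* (m ℕ.+ n))              ≡⟨ cong ι (ℕₚ.*-distribˡ-+ k m n) ⟩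
    ι (k ℕ.* m ℕ.+ k ℕ.* n)          ≡⟨ trans (cong₂ _+F_ (ι-* k m) (ι-* k n)) (ι-+ (k ℕ.* m) (k ℕ.* n)) ⟨
    (ι k *F ι m) +F (ι k *F ι n)     ∎
    where open ≡-Reasoning

  -F_ : F → F
  -F a = ι (p ℕ.∸ toℕ a)

  -F-inverseˡ : ∀ a → -F a +F a ≡ 0F
  -F-inverseˡ a = begin
    -F a +F a                     ≡⟨ cong (-F a +F_) (ι-toℕ a) ⟨
    -F a +F ι (toℕ a)             ≡⟨ ι-+ (p ℕ.∸ toℕ a) (toℕ a) ⟩
    ι (p ℕ.∸ toℕ a ℕ.+ toℕ a)     ≡⟨ cong ι (ℕₚ.m∸n+n≡m (ℕₚ.<⇒≤ (toℕ<n a))) ⟩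
    ι p                           ≡⟨ ι-p ⟩
    0F                            ∎
    where open ≡-Reasoning

  isCommutativeRing : IsCommutativeRing _≡_ _+F_ _*F_ -F_ 0F 1F
  isCommutativeRing = record
    { isRing = record
      { +-isAbelianGroup = record
        { isGroup = record
          { isMonoid = record
            { isSemigroup = record
              { isMagma = record { isEquivalence = isEquivalence ; ∙-cong = cong₂ _+F_ }
              ; assoc   = +F-assoc
              }
            ; identity = 0F+ , λ a → trans (+F-comm a 0F) (0F+ a)
            }
          ; inverse = -F-inverseˡ , λ a → trans (+F-comm a (-F a)) (-F-inverseˡ a)
          ; ⁻¹-cong = cong -F_
          }
        ; comm = +F-comm
        }
      ; *-cong     = cong₂ _*F_
      ; *-assoc    = *F-assoc
      ; *-identity = 1F* , λ a → trans (*F-comm a 1F) (1F* a)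
      ; distrib    = *F-distribˡ , λ a b c → trans (*F-comm (b +F c) a)
          (trans (*F-distribˡ a b c) (cong₂ _+F_ (*F-comm a b) (*F-comm a c)))
      }
    ; *-comm = *F-comm
    }

  commutativeRing : CommutativeRing _ _
  commutativeRing = record { isCommutativeRing = isCommutativeRing }

  open CommutativeRing commutativeRing using (zeroˡ; zeroʳ; +-identityʳ; distribʳ; ring; semiring)
  open import Algebra.Properties.Ring ring
    using (-0#≈0#; +-cancelˡ; +-cancelʳ)

  1<p : 1 ℕ.< p
  1<p = ℕ.nonTrivial⇒n>1 p {{prime⇒nonTrivial pr}}

  ι-nonzero : ∀ {m} → 0 ℕ.< m → m ℕ.< p → ι m ≢ 0F
  ι-nonzero {m} 0<m m<p ιm≡0 = ℕₚ.<⇒≢ 0<m (sym (begin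
    m            ≡⟨ m<n⇒m%n≡m m<p ⟨
    m % p        ≡⟨ toℕ-ι m ⟨
    toℕ (ι m)    ≡⟨ cong toℕ ιm≡0 ⟩
    toℕ 0F       ≡⟨ toℕ-ι 0 ⟩
    0 % p        ≡⟨ m<n⇒m%n≡m (ℕₚ.<-trans 0<m m<p) ⟩
    0            ∎))
    where open ≡-Reasoning

  1F≢0F : 1F ≢ 0F
  1F≢0F = ι-nonzero (s≤s z≤n) 1<p

  inverseF : ∀ a → a ≢ 0F → ∃ λ b → b *F a ≡ 1F
  inverseF a a≢0 = by-value (toℕ a) refl
    where
    open ≡-Reasoning
    by-value : ∀ n → toℕ a ≡ n → ∃ λ b → b *F a ≡ 1F
    by-value zero    eq = contradiction (trans (sym (ι-toℕ a)) (cong ι eq)) a≢0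
    by-value (suc m) eq with coprime-Bézout (prime⇒coprime {n = suc m} pr (subst (ℕ._< p) eq (toℕ<n a)))
    ... | Bézout.-+ x y 1+xp≡yn = ι y , (begin
      ι y *F a             ≡⟨ cong (ι y *F_) (trans (sym (ι-toℕ a)) (cong ι eq)) ⟩
      ι y *F ι (suc m)     ≡⟨ ι-* y (suc m) ⟩
      ι (y ℕ.* suc m)      ≡⟨ cong ι 1+xp≡yn ⟨
      ι (1 ℕ.+ x ℕ.* p)    ≡⟨ ι-cong ([m+kn]%n≡m%n 1 x p) ⟩
      1F                   ∎)
    -- In this sign case y times a is -1, so the inverse is the negative of y.
    ... | Bézout.+- x y 1+yn≡xp = -F ι y , +-cancelʳ (ι y *F a) _ _ (begin
      (-F ι y *F a) +F (ι y *F a)   ≡⟨ distribʳ a (-F ι y) (ι y) ⟨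
      (-F ι y +F ι y) *F a          ≡⟨ cong (_*F a) (-F-inverseˡ (ι y)) ⟩
      0F *F a                       ≡⟨ zeroˡ a ⟩
      0F                            ≡⟨ ι-cong ([m+kn]%n≡m%n 0 x p) ⟨
      ι (x ℕ.* p)                   ≡⟨ cong ι 1+yn≡xp ⟨
      ι (1 ℕ.+ y ℕ.* suc m)         ≡⟨ ι-+ 1 (y ℕ.* suc m) ⟨
      1F +F ι (y ℕ.* suc m)         ≡⟨ cong (1F +F_) (ι-* y (suc m)) ⟨
      1F +F (ι y *F ι (suc m))      ≡⟨ cong (λ b → 1F +F (ι y *F b)) (trans (cong ι (sym eq)) (ι-toℕ a)) ⟩
      1F +F (ι y *F a)              ∎)

  newton : ℕ → F → F
  newton zero    t = 1F
  newton (suc i) t = newton i t *F (t +F -F ι i)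

  sub-add : ∀ t a → (t +F -F a) +F a ≡ t
  sub-add t a = trans (+F-assoc t (-F a) a) (trans (cong (t +F_) (-F-inverseˡ a)) (+-identityʳ t))

  newton-suc : ∀ i t → t *F newton i t ≡ newton (suc i) t +F (ι i *F newton i t)
  newton-suc i t = begin
    t *F N                              ≡⟨ cong (_*F N) (sub-add t (ι i)) ⟨
    ((t +F -F ι i) +F ι i) *F N         ≡⟨ distribʳ N (t +F -F ι i) (ι i) ⟩
    ((t +F -F ι i) *F N) +F (ι i *F N)  ≡⟨ cong (_+F (ι i *F N)) (*F-comm (t +F -F ι i) N) ⟩
    newton (suc i) t +F (ι i *F N)      ∎
    where open ≡-Reasoning
          N = newton i t

  newton-shift : ∀ i t → newton (suc i) (1F +F t) ≡ (1F +F t) *F newton i t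
  newton-shift zero t = trans (*F-comm 1F _)
    (cong (_*F 1F) (trans (cong ((1F +F t) +F_) -0#≈0#) (+-identityʳ _)))
  newton-shift (suc i) t = trans
    (cong₂ _*F_ (newton-shift i t) (+-cancelʳ (ι (suc i)) _ _ (begin
      ((1F +F t) +F -F ι (suc i)) +F ι (suc i)   ≡⟨ sub-add (1F +F t) (ι (suc i)) ⟩
      1F +F t                                    ≡⟨ +F-comm 1F t ⟩
      t +F 1F                                    ≡⟨ cong (_+F 1F) (sub-add t (ι i)) ⟨
      ((t +F -F ι i) +F ι i) +F 1F               ≡⟨ +F-assoc (t +F -F ι i) (ι i) 1F ⟩
      (t +F -F ι i) +F (ι i +F 1F)               ≡⟨ cong ((t +F -F ι i) +F_) (trans (+F-comm (ι i) 1F) (ι-+ 1 i)) ⟩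
      (t +F -F ι i) +F ι (suc i)                 ∎)))
    (*F-assoc (1F +F t) (newton i t) (t +F -F ι i))
    where open ≡-Reasoning

  -- The discrete analogue of differentiating a power; it exhibits `newton i` as a difference up to
  -- the factor i + 1.
  newton-difference : ∀ i t → newton (suc i) (1F +F t) ≡ newton (suc i) t +F (ι (suc i) *F newton i t)
  newton-difference i t = begin
    newton (suc i) (1F +F t)              ≡⟨ newton-shift i t ⟩
    (1F +F t) *F N                        ≡⟨ distribʳ N 1F t ⟩
    (1F *F N) +F (t *F N)                 ≡⟨ cong ((1F *F N) +F_) (newton-suc i t) ⟩
    (1F *F N) +F (newton (suc i) t +F (ι i *F N))
      ≡⟨ trans (+F-comm (1F *F N) _) (+F-assoc (newton (suc i) t) (ι i *F N) (1F *F N)) ⟩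
    newton (suc i) t +F ((ι i *F N) +F (1F *F N))
      ≡⟨ cong (newton (suc i) t +F_) (sym (distribʳ N (ι i) 1F)) ⟩
    newton (suc i) t +F ((ι i +F 1F) *F N)
      ≡⟨ cong (λ a → newton (suc i) t +F (a *F N)) (trans (+F-comm (ι i) 1F) (ι-+ 1 i)) ⟩
    newton (suc i) t +F (ι (suc i) *F N)  ∎
    where open ≡-Reasoning
          N = newton i t

  open import Algebra.Properties.Semiring.Sum semiring using (sum; sum-cong-≗; *-distribˡ-sum)

  telescope : ∀ (H h : ℕ → F) → (∀ j → H (suc j) ≡ H j +F h j) →
              ∀ n → H n ≡ H 0 +F sum {n} (λ j → h (toℕ j))
  telescope H h step zero    = sym (+-identityʳ (H 0))
  telescope H h step (suc n) = begin
    H (suc n)            ≡⟨ telescope (H ∘ suc) (h ∘ suc) (step ∘ suc) n ⟩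
    H 1 +F S             ≡⟨ cong (_+F S) (step 0) ⟩
    (H 0 +F h 0) +F S    ≡⟨ +F-assoc (H 0) (h 0) S ⟩
    H 0 +F (h 0 +F S)    ∎
    where
    open ≡-Reasoning
    S : F
    S = sum {n} (λ j → h (suc (toℕ j)))

  -- Since i + 1 < p, the factor i + 1 in `newton-difference` is invertible, and the differences
  -- telescope once around F_p, back to the starting value.
  newton-sum : ∀ i → suc i ℕ.< p → sum (newton i) ≡ 0F
  newton-sum i 1+i<p with inverseF (ι (suc i)) (ι-nonzero (s≤s z≤n) 1+i<p)
  ... | r , r*ι≡1 = begin
    sum (newton i)                            ≡⟨ 1F* _ ⟨
    1F *F sum (newton i)                      ≡⟨ cong (_*F sum (newton i)) r*ι≡1 ⟨
    (r *F ι (suc i)) *F sum (newton i)        ≡⟨ *F-assoc r (ι (suc i)) _ ⟩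
    r *F (ι (suc i) *F sum (newton i))        ≡⟨ cong (r *F_) (*-distribˡ-sum (ι (suc i)) (newton i)) ⟩
    r *F sum (λ t → ι (suc i) *F newton i t)  ≡⟨ cong (r *F_) differences ⟩
    r *F 0F                                   ≡⟨ zeroʳ r ⟩
    0F                                        ∎
    where
    open ≡-Reasoning
    H h : ℕ → F
    H j = newton (suc i) (ι j)
    h j = ι (suc i) *F newton i (ι j)
    differences : sum (λ t → ι (suc i) *F newton i t) ≡ 0F
    differences = +-cancelˡ (H 0) _ _ (begin
      H 0 +F sum (λ t → ι (suc i) *F newton i t)
        ≡⟨ cong (H 0 +F_) (sum-cong-≗ (λ t → cong (λ s → ι (suc i) *F newton i s) (ι-toℕ t))) ⟨
      H 0 +F sum {p} (λ t → h (toℕ t))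
        ≡⟨ telescope H h (λ j → trans (cong (newton (suc i)) (sym (ι-+ 1 j))) (newton-difference i (ι j))) p ⟨
      H p
        ≡⟨ cong (newton (suc i)) ι-p ⟩
      H 0
        ≡⟨ +-identityʳ (H 0) ⟨
      H 0 +F 0F ∎)

  primeField : PrimeField p (ℕ.pred p)
  primeField = record
    { p≡1+q = sym (ℕₚ.suc-pred p)
    ; 1≤q = ℕₚ.≤-pred (subst (1 ℕ.<_) (sym (ℕₚ.suc-pred p)) 1<p)
    ; isCommutativeRing = isCommutativeRing
    ; 1≢0 = 1F≢0F
    ; inverse = inverseF
    ; node = ι
    ; newton = newton
    ; newton-zero = λ _ → refl
    ; newton-suc = newton-suc
    ; newton-sum = λ i i<q → newton-sum i (subst (suc i ℕ.<_) (ℕₚ.suc-pred p) (s≤s i<q))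
    }

-- Subspace indicators, and the passage between points and vectors

module Projective {p q : ℕ} (K : PrimeField p q) where
  open PrimeField K
  open LinearAlgebra K
  open Orthogonality K
  open Weights K
  open NatSum using (sum-const; sum-except)
  open Reindex ℕₚ.+-0-commutativeMonoid using (ΣV-scale)

  combination : ∀ {m r} → V r → Vec (V m) r → V m
  combination []      []      = 𝟎
  combination (a ∷ α) (b ∷ B) = a ⊙ b ⊕ combination α B

  combination-⊕ : ∀ {m r} (α β : V r) (B : Vec (V m) r) →
    combination (α ⊕ β) B ≡ combination α B ⊕ combination β B
  combination-⊕ []      []      []      = sym (𝟎⊕ 𝟎)
  combination-⊕ (a ∷ α) (c ∷ β) (b ∷ B) = trans
    (cong₂ _⊕_ (⊙-+ a c b) (combination-⊕ α β B)) (⊕-interchange (a ⊙ b) (c ⊙ b) _ _)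

  combination-⊙ : ∀ {m r} s (α : V r) (B : Vec (V m) r) → combination (s ⊙ α) B ≡ s ⊙ combination α B
  combination-⊙ s []      []      = sym (⊙𝟎 s)
  combination-⊙ s (a ∷ α) (b ∷ B) = trans
    (cong₂ _⊕_ (sym (⊙-⊙ s a b)) (combination-⊙ s α B)) (sym (⊙-⊕ s (a ⊙ b) _))

  _≟ⱽ_ : ∀ {m} (x y : V m) → Dec (x ≡ y)
  _≟ⱽ_ = ≡-dec _≟_

  δ : ∀ {m} → V m → V m → F
  δ x y = if does (x ≟ⱽ y) then 1# else 0#

  δ-yes : ∀ {m} {x y : V m} → x ≡ y → δ x y ≡ 1#
  δ-yes {x = x} {y} x≡y with x ≟ⱽ y
  ... | yes _  = refl
  ... | no x≢y = contradiction x≡y x≢y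

  δ-no : ∀ {m} {x y : V m} → x ≢ y → δ x y ≡ 0#
  δ-no {x = x} {y} x≢y with x ≟ⱽ y
  ... | yes x≡y = contradiction x≡y x≢y
  ... | no _    = refl

  δ-⇔ : ∀ {m n} {w x : V m} {y z : V n} → (w ≡ x → y ≡ z) → (y ≡ z → w ≡ x) → δ w x ≡ δ y z
  δ-⇔ {w = w} {x} to from with w ≟ⱽ x
  ... | yes w≡x = sym (δ-yes (to w≡x))
  ... | no  w≢x = sym (δ-no (w≢x ∘ from))

  -- The number of representations of x as a combination of B, as a field element.
  representations : ∀ {m r} → Vec (V m) r → V m → F
  representations []      = δ 𝟎
  representations (v ∷ B) = spread v (representations B)

  -- Each basis vector contributes one spread, hence q orders, starting from the point mass at the
  -- origin with none.
  representations-orth : ∀ {m r} (B : Vec (V m) r) → Orth (r ℕ.* q) (representations B)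
  representations-orth []                = _
  representations-orth {r = suc r} (v ∷ B) = orth-spread (r ℕ.* q) v (representations B) (representations-orth B)

  representations-homogeneous : ∀ {m r} (B : Vec (V m) r) → Homogeneous (representations B)
  representations-homogeneous [] s x s≢0 = δ-⇔ scale-back (λ 𝟎≡x → trans (sym (⊙𝟎 s)) (cong (s ⊙_) 𝟎≡x))
    where
    scale-back : 𝟎 ≡ s ⊙ x → 𝟎 ≡ x
    scale-back 𝟎≡sx with inverse s s≢0
    ... | r , rs≡1 = trans (sym (⊙𝟎 r)) (trans (cong (r ⊙_) 𝟎≡sx) (⊙-inverse rs≡1 x))
  representations-homogeneous (v ∷ B) s x s≢0 with inverse s s≢0
  ... | r , rs≡1 = begin
    S.sum (λ t → g (s ⊙ x ⊕ (- t) ⊙ v))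
      ≡⟨ S.sum-reindex (λ t → g (s ⊙ x ⊕ (- t) ⊙ v)) (s *_) (r *_)
           (λ t → cancel (trans (*-comm s r) rs≡1) t) (λ t → cancel rs≡1 t) ⟨
    S.sum (λ t → g (s ⊙ x ⊕ (- (s * t)) ⊙ v))
      ≡⟨ S.sum-cong (λ t → trans (cong g (sym (⊙-⊖ s x t v)))
           (representations-homogeneous B s (x ⊕ (- t) ⊙ v) s≢0)) ⟩
    S.sum (λ t → g (x ⊕ (- t) ⊙ v)) ∎
    where
    open ≡-Reasoning
    g = representations B
    cancel : ∀ {a b} → a * b ≡ 1# → ∀ t → a * (b * t) ≡ t
    cancel {a} {b} ab≡1 t = trans (sym (*-assoc a b t)) (trans (cong (_* t) ab≡1) (*-identityˡ t))

  representations-sum : ∀ {m r} (B : Vec (V m) r) x →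
    representations B x ≡ S.ΣV (λ α → δ (combination α B) x)
  representations-sum []      x = refl
  representations-sum (v ∷ B) x = S.sum-cong (λ s → trans
    (representations-sum B (x ⊕ (- s) ⊙ v))
    (S.ΣV-cong (λ α → δ-⇔ (to s α) (from s α))))
    where
    to : ∀ s α → combination α B ≡ x ⊕ (- s) ⊙ v → s ⊙ v ⊕ combination α B ≡ x
    to s α eq = trans (⊕-comm (s ⊙ v) _) (trans (cong (_⊕ s ⊙ v) eq) (⊙-⊕-cancel x s v))
    from : ∀ s α → s ⊙ v ⊕ combination α B ≡ x → combination α B ≡ x ⊕ (- s) ⊙ v
    from s α eq = trans (sym (⊕-⊙-cancel (combination α B) s v))
      (cong (_⊕ (- s) ⊙ v) (trans (⊕-comm (combination α B) (s ⊙ v)) eq))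

  module _ {m r} (B : Vec (V m) r) (independent : ∀ α → combination α B ≡ 𝟎 → α ≡ 𝟎) where

    combination-injective : ∀ α β → combination α B ≡ combination β B → α ≡ β
    combination-injective α β eq = begin
      α                                   ≡⟨ ⊙-⊕-cancel α 1# β ⟨
      α ⊕ (- 1#) ⊙ β ⊕ 1# ⊙ β             ≡⟨ cong (_⊕ 1# ⊙ β) (independent _ difference) ⟩
      𝟎 ⊕ 1# ⊙ β                          ≡⟨ trans (𝟎⊕ _) (1⊙ β) ⟩
      β                                   ∎
      where
      open ≡-Reasoning
      difference : combination (α ⊕ (- 1#) ⊙ β) B ≡ 𝟎
      difference = begin
        combination (α ⊕ (- 1#) ⊙ β) B
          ≡⟨ trans (combination-⊕ α ((- 1#) ⊙ β) B) (cong (combination α B ⊕_) (combination-⊙ (- 1#) β B)) ⟩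
        combination α B ⊕ (- 1#) ⊙ combination β B
          ≡⟨ cong (_⊕ (- 1#) ⊙ combination β B) (trans eq (sym (trans (𝟎⊕ _) (1⊙ _)))) ⟩
        𝟎 ⊕ 1# ⊙ combination β B ⊕ (- 1#) ⊙ combination β B
          ≡⟨ ⊕-⊙-cancel 𝟎 1# (combination β B) ⟩
        𝟎 ∎

    -- Counting the coefficient vectors that produce x decides membership, and independence leaves
    -- at most one of them.
    representations-indicator : ∀ x →
      (∃ λ α → combination α B ≡ x) × representations B x ≡ 1# ⊎
      ¬ (∃ λ α → combination α B ≡ x) × representations B x ≡ 0#
    representations-indicator x with weight (λ α → δ (combination α B) x) in w≡
    ... | zero  = inj₂ ((λ { (α , eq) → 1≢0 (trans (sym (δ-yes eq)) (weight-zero h w≡ α)) }) ,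
                        trans (representations-sum B x) (S.ΣV-zero (weight-zero h w≡)))
      where h = λ α → δ (combination α B) x
    ... | suc _ = inj₁ ((α , eq) , trans (representations-sum B x)
      (trans (S.ΣV-single h α (λ β β≢α → δ-no (λ eq′ → β≢α (combination-injective β α (trans eq′ (sym eq))))))
             (δ-yes eq)))
      where
      h = λ α → δ (combination α B) x
      witness = weight-witness h (subst (1 ≤_) (sym w≡) (s≤s z≤n))
      α = proj₁ witness
      eq : combination α B ≡ x
      eq with combination α B ≟ⱽ x
      ... | yes eq = eq
      ... | no  ≢x = contradiction (δ-no ≢x) (proj₂ witness)

  normal : ∀ {m} → V m → Bool
  normal []      = false
  normal (a ∷ x) = if does (a ≟ 0#) then normal x else does (a ≟ 1#)

  normal-weight : ∀ {m} → (V m → F) → ℕ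
  normal-weight f = C.ΣV (λ x → if normal x then nz (f x) else 0)

  normal-weight-suc : ∀ {m} (f : V (suc m) → F) →
    normal-weight f ≡ normal-weight (λ x → f (0# ∷ x)) ℕ.+ weight (λ x → f (1# ∷ x))
  normal-weight-suc {m} f = begin
    C.sum (λ t → C.ΣV (λ x → if normal (t ∷ x) then nz (f (t ∷ x)) else 0))
      ≡⟨ C.sum-cong split ⟩
    C.sum (λ t → at-0 t ℕ.+ at-1 t)
      ≡⟨ C.∑-distrib-+ at-0 at-1 ⟩
    C.sum at-0 ℕ.+ C.sum at-1
      ≡⟨ cong₂ ℕ._+_ (trans (C.sum-single at-0 0# (λ t → when-no)) (when-yes {0#} refl))
                     (trans (C.sum-single at-1 1# (λ t → when-no)) (when-yes {1#} refl)) ⟩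
    normal-weight (λ x → f (0# ∷ x)) ℕ.+ weight (λ x → f (1# ∷ x)) ∎
    where
    open ≡-Reasoning
    at-0 at-1 : F → ℕ
    at-0 t = when (t ≟ 0#) (normal-weight (λ x → f (t ∷ x)))
    at-1 t = when (t ≟ 1#) (weight (λ x → f (t ∷ x)))
    when-no : ∀ {t s a} → t ≢ s → when (t ≟ s) a ≡ 0
    when-no {t} {s} t≢s with t ≟ s
    ... | yes t≡s = contradiction t≡s t≢s
    ... | no  _   = refl
    when-yes : ∀ {t s a} → t ≡ s → when (t ≟ s) a ≡ a
    when-yes {t} {s} t≡s with t ≟ s
    ... | yes _   = refl
    ... | no  t≢s = contradiction t≡s t≢s
    split : ∀ t → C.ΣV (λ x → if normal (t ∷ x) then nz (f (t ∷ x)) else 0) ≡ at-0 t ℕ.+ at-1 t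
    split t with t ≟ 0# | t ≟ 1#
    ... | yes t≡0 | yes t≡1 = contradiction (trans (sym t≡1) t≡0) 1≢0
    ... | yes _   | no  _   = sym (ℕₚ.+-identityʳ _)
    ... | no  _   | yes _   = refl
    ... | no  _   | no  _   = C.ΣV-zero {m} (λ _ → refl)

  -- Each point has q nonzero multiples, one of them normalized. By induction on the coordinates: a
  -- nonzero head can be scaled to 1, a zero head is dropped.
  weight-normal : ∀ {m} {f : V m → F} → Homogeneous f → weight f ≡ nz (f 𝟎) ℕ.+ q ℕ.* normal-weight f
  weight-normal {zero}  {f} hom = sym (trans (cong (nz (f []) ℕ.+_) (ℕₚ.*-zeroʳ q)) (ℕₚ.+-identityʳ _))
  weight-normal {suc m} {f} hom = begin
    weight f
      ≡⟨ sum-except (λ t → weight (λ x → f (t ∷ x))) 0# (weight (λ x → f (1# ∷ x))) p≡1+q rescale ⟩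
    weight (λ x → f (0# ∷ x)) ℕ.+ q ℕ.* weight (λ x → f (1# ∷ x))
      ≡⟨ cong (ℕ._+ q ℕ.* weight (λ x → f (1# ∷ x))) (weight-normal hom₀) ⟩
    nz (f 𝟎) ℕ.+ q ℕ.* normal-weight (λ x → f (0# ∷ x)) ℕ.+ q ℕ.* weight (λ x → f (1# ∷ x))
      ≡⟨ solve 4 (λ z q a b → z :+ q :* a :+ q :* b := z :+ q :* (a :+ b)) refl (nz (f 𝟎)) q
           (normal-weight (λ x → f (0# ∷ x))) (weight (λ x → f (1# ∷ x))) ⟩
    nz (f 𝟎) ℕ.+ q ℕ.* (normal-weight (λ x → f (0# ∷ x)) ℕ.+ weight (λ x → f (1# ∷ x)))
      ≡⟨ cong (λ a → nz (f 𝟎) ℕ.+ q ℕ.* a) (normal-weight-suc f) ⟨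
    nz (f 𝟎) ℕ.+ q ℕ.* normal-weight f ∎
    where
    open ≡-Reasoning
    open +-*-Solver
    hom₀ : Homogeneous (λ x → f (0# ∷ x))
    hom₀ s x s≢0 = trans (cong (λ a → f (a ∷ s ⊙ x)) (sym (zeroʳ s))) (hom s (0# ∷ x) s≢0)
    rescale : ∀ t → t ≢ 0# → weight (λ x → f (t ∷ x)) ≡ weight (λ x → f (1# ∷ x))
    rescale t t≢0 = trans (sym (ΣV-scale (λ x → nz (f (t ∷ x))) t t≢0))
      (weight-cong (λ x → trans (cong (λ a → f (a ∷ t ⊙ x)) (sym (*-identityʳ t))) (hom t (1# ∷ x) t≢0)))

  -- Double counting of the pairs of an index i and a vector x with `e i ≡ x`.
  enumeration-length : ∀ {m w} (e : Fin w → V m) (N : V m → ℕ) →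
    (∀ {i j} → e i ≡ e j → i ≡ j) → (∀ i → N (e i) ≡ 1) →
    (∀ x → (∃ λ i → e i ≡ x) ⊎ N x ≡ 0) → w ≡ C.ΣV N
  enumeration-length {m} {w} e N injective N≡1 surjective = begin
    w                                                  ≡⟨ ℕₚ.*-identityʳ w ⟨
    w ℕ.* 1                                            ≡⟨ sum-const w 1 ⟨
    C.sum {w} (λ _ → 1)                                ≡⟨ C.sum-cong one ⟨
    C.sum (λ i → C.ΣV (λ x → hit i x))                 ≡⟨ C.sum-ΣV-comm hit ⟩
    C.ΣV (λ x → C.sum (λ i → hit i x))                 ≡⟨ C.ΣV-cong (λ x → count x (surjective x)) ⟩
    C.ΣV N                                             ∎
    where
    open ≡-Reasoning
    hit : Fin w → V m → ℕ
    hit i x = when (e i ≟ⱽ x) 1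
    hit-yes : ∀ {i x} → e i ≡ x → hit i x ≡ 1
    hit-yes {i} {x} eq with e i ≟ⱽ x
    ... | yes _  = refl
    ... | no  ≢x = contradiction eq ≢x
    hit-no : ∀ {i x} → e i ≢ x → hit i x ≡ 0
    hit-no {i} {x} ≢x with e i ≟ⱽ x
    ... | yes eq = contradiction eq ≢x
    ... | no  _  = refl
    one : ∀ i → C.ΣV (hit i) ≡ 1
    one i = trans (C.ΣV-single (hit i) (e i) (λ x x≢ → hit-no (x≢ ∘ sym))) (hit-yes {i} refl)
    count : ∀ x → (∃ λ i → e i ≡ x) ⊎ N x ≡ 0 → C.sum (λ i → hit i x) ≡ N x
    count x (inj₁ (i , eq)) = trans
      (C.sum-single (λ i → hit i x) i (λ j j≢i → hit-no {j} (λ eq′ → j≢i (injective (trans eq′ (sym eq))))))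
      (trans (hit-yes {i} eq) (trans (sym (N≡1 i)) (cong N eq)))
    count x (inj₂ N≡0) = trans
      (C.sum-zero (λ i → hit-no {i} (λ eq → contradiction (trans (sym (N≡1 i)) (trans (cong N eq) N≡0)) λ ())))
      (sym N≡0)

-- From codewords to homogeneous functions, and the weight gap

open import Data.Nat using (_+_; _*_)

module Codewords (p : ℕ) (pr : Prime p) where
  open PG p pr using (Point; Word; Term; evalTerms; lincomb; normalized; HasWeight; p≢0)
  open IntegersMod p pr using (primeField; ι; toℕ-ι; ι-toℕ; 1<p)
  open PrimeField primeField renaming (_+_ to _+ᶠ_; _*_ to _*ᶠ_)
  open LinearAlgebra primeField
  open Orthogonality primeField
  open Weights primeField
  open Hyperplanes primeField using (light-vanishes)
  open FlatTheorem primeField using (light-flat)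
  open Projective primeField

  q : ℕ
  q = ℕ.pred p

  lincomb≡combination : ∀ {m r} (α : V r) (B : Vec (V m) r) → lincomb α B ≡ combination α B
  lincomb≡combination []      []      = refl
  lincomb≡combination (a ∷ α) (b ∷ B) = cong (a ⊙ b ⊕_) (lincomb≡combination α B)

  -- The function on F_p^(n+1) obtained by extending each incidence vector to the whole
  -- vector subspace, zero vector included.
  lift : ∀ {n k} → List (Term n k) → V (suc n) → F
  lift []       x = 0#
  lift (t ∷ ts) x = Term.coeff t *ᶠ representations (proj₁ (Term.subsp t)) x +ᶠ lift ts x

  lift-orth : ∀ {n k} (ts : List (Term n k)) → Orth (suc k * q) (lift ts)
  lift-orth {k = k} []       = orth-zero (suc k * q)
  lift-orth {k = k} (t ∷ ts) = orth-+ (suc k * q)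
    (orth-*ˡ (suc k * q) (Term.coeff t) (representations-orth (proj₁ (Term.subsp t)))) (lift-orth ts)

  lift-homogeneous : ∀ {n k} (ts : List (Term n k)) → Homogeneous (lift ts)
  lift-homogeneous []       s x s≢0 = refl
  lift-homogeneous (t ∷ ts) s x s≢0 = cong₂ (λ a b → Term.coeff t *ᶠ a +ᶠ b)
    (representations-homogeneous (proj₁ (Term.subsp t)) s x s≢0) (lift-homogeneous ts s x s≢0)

  -- The clauses of `IsIncidence` ask for a proof of membership or of non-membership;
  -- `representations-indicator` provides one of them together with the matching value.
  incidence : ∀ {n k} (t : Term n k) (x : Point n) →
    Term.chi t x ≡ representations (proj₁ (Term.subsp t)) (proj₁ x)
  incidence t x
    with representations-indicator (proj₁ (Term.subsp t))
           (λ α eq → proj₂ (Term.subsp t) α (trans (lincomb≡combination α _) eq)) (proj₁ x)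
  ... | inj₁ ((α , eq) , ≡1) = trans
    (proj₁ (Term.isInc t x) (α , trans (lincomb≡combination α _) eq)) (sym ≡1)
  ... | inj₂ (∉ , ≡0) = trans
    (proj₂ (Term.isInc t x) λ { (α , eq) → ∉ (α , trans (sym (lincomb≡combination α _)) eq) }) (sym ≡0)

  evalTerms≡lift : ∀ {n k} (ts : List (Term n k)) x → evalTerms ts x ≡ lift ts (proj₁ x)
  evalTerms≡lift []       x = refl
  evalTerms≡lift (t ∷ ts) x = cong₂ (λ a b → Term.coeff t *ᶠ a +ᶠ b) (incidence t x) (evalTerms≡lift ts x)

  ≡ᵇ-does : ∀ (a : F) n → n < p → (toℕ a ℕ.≡ᵇ n) ≡ does (a ≟ ι n)
  ≡ᵇ-does a n n<p with toℕ a ℕ.≡ᵇ n in eq | a ≟ ι n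
  ... | true  | yes _    = refl
  ... | false | no  _    = refl
  ... | true  | no  a≢ιn = contradiction
    (trans (sym (ι-toℕ a)) (cong ι (ℕₚ.≡ᵇ⇒≡ (toℕ a) n (subst T (sym eq) _)))) a≢ιn
  ... | false | yes refl = contradiction
    (subst T eq (ℕₚ.≡⇒≡ᵇ (toℕ (ι n)) n (trans (toℕ-ι n) (m<n⇒m%n≡m n<p)))) λ ()
    where open import Data.Nat.DivMod using (m<n⇒m%n≡m)

  normalized≡normal : ∀ {m} (x : V m) → normalized x ≡ normal x
  normalized≡normal []      = refl
  normalized≡normal (a ∷ x)
    rewrite ≡ᵇ-does a 0 (ℕₚ.<-trans (s≤s z≤n) 1<p) | ≡ᵇ-does a 1 1<p | normalized≡normal x = refl

  support-size : ∀ {n} (c : Word n) (f : V (suc n) → F) → (∀ x → c x ≡ f (proj₁ x)) →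
    ∀ w → HasWeight c w → w ≡ normal-weight f
  support-size {n} c f c≡f w bijection = enumeration-length e N e-injective N≡1 e-surjective
    where
    open Inverse bijection using (to; from; strictlyInverseˡ; strictlyInverseʳ)
    e : Fin w → V (suc n)
    e i = proj₁ (proj₁ (to i))
    N : V (suc n) → ℕ
    N x = if normal x then nz (f x) else 0
    same-point : ∀ (s t : Σ (Point n) (λ x → ¬ (c x ≡ 0#))) → proj₁ (proj₁ s) ≡ proj₁ (proj₁ t) → s ≡ t
    same-point ((x , nx) , _) ((.x , nx′) , _) refl with T-irrelevant nx nx′
    ... | refl = refl
    e-injective : ∀ {i j} → e i ≡ e j → i ≡ j
    e-injective {i} {j} eq = trans (sym (strictlyInverseʳ i))
      (trans (cong from (same-point (to i) (to j) eq)) (strictlyInverseʳ j))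
    N≡1 : ∀ i → N (e i) ≡ 1
    N≡1 i with normal (e i) | subst T (normalized≡normal (e i)) (proj₂ (proj₁ (to i)))
    ... | true | _ = nz-nonzero (proj₂ (to i) ∘ trans (c≡f (proj₁ (to i))))
    e-surjective : ∀ x → (∃ λ i → e i ≡ x) ⊎ N x ≡ 0
    e-surjective x with normal x in normal≡ | f x ≟ 0#
    ... | false | _        = inj₂ refl
    ... | true  | yes _    = inj₂ refl
    ... | true  | no  fx≢0 = inj₁ (from s , cong (proj₁ ∘ proj₁) (strictlyInverseˡ s))
      where
      s : Σ (Point n) (λ x → ¬ (c x ≡ 0#))
      s = (x , subst T (sym (trans (normalized≡normal x) normal≡)) _) , fx≢0 ∘ trans (sym (c≡f _))

  -- A vector space of dimension k + 1 consists of the origin and q multiples for each of its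
  -- points.
  θ-geometric : ∀ k → suc (q * θ p k) ≡ p ^ suc k
  θ-geometric zero    = trans (cong suc (ℕₚ.*-identityʳ q)) (trans (sym p≡1+q) (sym (ℕₚ.*-identityʳ p)))
  θ-geometric (suc k) = begin
    suc (q * (p ^ suc k + θ p k))
      ≡⟨ solve 3 (λ q P t → con 1 :+ q :* (P :+ t) := q :* P :+ (con 1 :+ q :* t)) refl q (p ^ suc k) (θ p k) ⟩
    q * p ^ suc k + suc (q * θ p k)
      ≡⟨ cong (q * p ^ suc k +_) (θ-geometric k) ⟩
    q * p ^ suc k + p ^ suc k
      ≡⟨ ℕₚ.+-comm _ (p ^ suc k) ⟩
    suc q * p ^ suc k
      ≡⟨ cong (_* p ^ suc k) p≡1+q ⟨
    p ^ suc (suc k) ∎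
    where open ≡-Reasoning
          open +-*-Solver

  -- In either case w < 2p^k is exactly the lightness hypothesis in vector dimension k + 1. It
  -- forces w = 0 or w = `θ p k`, both excluded by the strict lower bound.
  gap : ∀ {n} k (f : V n → F) → Homogeneous f → Orth (suc k * q) f →
        ∀ w → weight f ≡ nz (f 𝟎) + q * w → ¬ (θ p k < w × w < 2 * p ^ k)
  gap k f hom o w weight≡ (θ<w , w<2pᵏ) with f 𝟎 ≟ 0#
  ... | yes f𝟎≡0 = ℕₚ.<⇒≢ (ℕₚ.≤-trans (s≤s z≤n) θ<w) (sym w≡0)
    where
    weight≡q*w : weight f ≡ q * w
    weight≡q*w = weight≡
    light : p * weight f < 2 * (q * p ^ suc k)
    light = begin-strict
      p * weight f                ≡⟨ cong (p *_) weight≡q*w ⟩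
      p * (q * w)                 <⟨ ℕₚ.*-monoʳ-< p (ℕₚ.*-monoʳ-< q {{ℕ.>-nonZero 1≤q}} w<2pᵏ) ⟩
      p * (q * (2 * p ^ k))       ≡⟨ solve 3 (λ p q P → p :* (q :* (con 2 :* P)) := con 2 :* (q :* (p :* P))) refl p q (p ^ k) ⟩
      2 * (q * p ^ suc k)         ∎
      where open ℕₚ.≤-Reasoning
            open +-*-Solver
    w≡0 : w ≡ 0
    w≡0 = ℕₚ.*-cancelˡ-≡ w 0 q {{ℕ.>-nonZero 1≤q}}
      (trans (sym weight≡q*w) (trans (light-vanishes (suc k) f hom o f𝟎≡0 light) (sym (ℕₚ.*-zeroʳ q))))
  ... | no f𝟎≢0 = ℕₚ.<⇒≢ θ<w (sym w≡θ)
    where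
    weight≡1+q*w : weight f ≡ suc (q * w)
    weight≡1+q*w = weight≡
    light : p * weight f < 2 * (q * p ^ suc k) + p
    light = begin-strict
      p * weight f                ≡⟨ cong (p *_) weight≡1+q*w ⟩
      p * suc (q * w)             ≡⟨ trans (ℕₚ.*-suc p (q * w)) (ℕₚ.+-comm p _) ⟩
      p * (q * w) + p             <⟨ ℕₚ.+-monoˡ-< p (ℕₚ.*-monoʳ-< p (ℕₚ.*-monoʳ-< q {{ℕ.>-nonZero 1≤q}} w<2pᵏ)) ⟩
      p * (q * (2 * p ^ k)) + p   ≡⟨ cong (_+ p) (solve 3 (λ p q P → p :* (q :* (con 2 :* P)) := con 2 :* (q :* (p :* P))) refl p q (p ^ k)) ⟩
      2 * (q * p ^ suc k) + p     ∎
      where open ℕₚ.≤-Reasoning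
            open +-*-Solver
    w≡θ : w ≡ θ p k
    w≡θ = ℕₚ.*-cancelˡ-≡ w (θ p k) q {{ℕ.>-nonZero 1≤q}} (ℕₚ.suc-injective
      (trans (sym weight≡1+q*w) (trans (proj₁ (light-flat (suc k) f hom o f𝟎≢0 light)) (sym (θ-geometric k)))))

theorem4p15 : (p : ℕ) (pr : Prime p) (n k : ℕ) → n ≤ 2 * k → k + 1 ≤ n →
    (c : PG.Word p pr n) → PG.InCode p pr n k c →
    (w : ℕ) → PG.HasWeight p pr c w →
    ¬ (θ p k < w × w < 2 * p ^ k)
theorem4p15 p pr n k _ _ c (ts , c≡) w bijection =
  gap k (lift ts) (lift-homogeneous ts) (lift-orth ts) w
    (trans (weight-normal (lift-homogeneous ts))
      (cong (λ v → nz (lift ts 𝟎) + q * v)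
        (sym (support-size c (lift ts) (λ x → trans (c≡ x) (evalTerms≡lift ts x)) w bijection))))
  where
  open Codewords p pr
  open IntegersMod p pr using (primeField)
  open LinearAlgebra primeField using (𝟎)
  open Weights primeField using (nz)
  open Projective primeField using (weight-normal)
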